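{- Let $r$ be a complex number such that $r^2\in\mathbb{Q}\setminus\{0\}$ (so $r$ is either real or purely imaginary). Then $r\tan r$ is irrational, i.e. $r\tan r\notin\mathbb{Q}$.
   Context: Here $\tan r=\sin r/\cos r$, where $\sin$ and $\cos$ are the entire complex functions. The case $r^2<0$ is included; writing $r=i\rho$ with $\rho$ real, one has $r\tan r=-\rho\tanh\rho$. -}

module Defs where

open import Data.Integer.Base as ℤ using (+_; -[1+_]; -1ℤ)
import Data.Integer.Properties as ℤ
open import Data.Nat.Base as ℕ using (ℕ; zero; suc; _!)
import Data.Nat.Properties as ℕ
open import Data.Nat.Properties using (_!≢0)
open import Data.Product.Base using (Σ-syntax; ∃-syntax; _×_; _,_; proj₁; proj₂)
open import Data.Rational.Base
open import Data.Rational.Properties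
open import Data.Rational.Solver using (module +-*-Solver)
import Data.Rational.Unnormalised.Base as ℚᵘ
import Data.Rational.Unnormalised.Properties as ℚᵘ
open import Data.Sum.Base using (_⊎_; inj₁; inj₂)
open import Relation.Binary.PropositionalEquality
  using (_≡_; refl; sym; trans; cong; cong₂; subst; subst₂)

open +-*-Solver using (solve; _:=_; _:+_; _:*_; _:-_; :-_; con)

private variable
  m n : ℕ
  a b c d p q ε : ℚ

≤-by : a ≡ b → c ≡ d → b ≤ d → a ≤ c
≤-by refl refl b≤d = b≤d

½-pos : 0ℚ < ε → 0ℚ < ½ * ε
½-pos {ε} 0<ε = subst (_< ½ * ε) (*-zeroʳ ½) (*-monoʳ-<-pos ½ 0<ε)

½+½ : ∀ ε → ½ * ε + ½ * ε ≡ ε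
½+½ = solve 1 (λ e → con ½ :* e :+ con ½ :* e := e) refl

¼-pos : 0ℚ < ε → 0ℚ < ½ * (½ * ε)
¼-pos 0<ε = ½-pos (½-pos 0<ε)

¼+¼+¼+¼ : ∀ ε → ½ * (½ * ε) + ½ * (½ * ε) + (½ * (½ * ε) + ½ * (½ * ε)) ≡ ε
¼+¼+¼+¼ ε = trans (cong₂ _+_ (½+½ (½ * ε)) (½+½ (½ * ε))) (½+½ ε)

*-mono-≤-nonNeg : 0ℚ ≤ a → 0ℚ ≤ d → a ≤ b → c ≤ d → a * c ≤ b * d
*-mono-≤-nonNeg {a} {d} 0≤a 0≤d a≤b c≤d = ≤-trans
  (*-monoˡ-≤-nonNeg a {{nonNegative 0≤a}} c≤d)
  (*-monoʳ-≤-nonNeg d {{nonNegative 0≤d}} a≤b)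

*-nonNeg : 0ℚ ≤ a → 0ℚ ≤ b → 0ℚ ≤ a * b
*-nonNeg {a} {b} 0≤a 0≤b =
  subst (_≤ a * b) (*-zeroʳ a) (*-monoˡ-≤-nonNeg a {{nonNegative 0≤a}} 0≤b)

∣*∣-bound : ∣ a ∣ ≤ p → ∣ b ∣ ≤ q → ∣ a * b ∣ ≤ p * q
∣*∣-bound {a} {p} {b} {q} a≤p b≤q = subst (_≤ p * q) (sym (∣p*q∣≡∣p∣*∣q∣ a b))
  (*-mono-≤-nonNeg (0≤∣p∣ a) (≤-trans (0≤∣p∣ b) b≤q) a≤p b≤q)

∣+∣-bound : ∣ a ∣ ≤ p → ∣ b ∣ ≤ q → ∣ a + b ∣ ≤ p + q
∣+∣-bound {a} {p} {b} {q} a≤p b≤q = ≤-trans (∣p+q∣≤∣p∣+∣q∣ a b) (+-mono-≤ a≤p b≤q)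

∣-∣-bound : ∣ a ∣ ≤ p → ∣ - a ∣ ≤ p
∣-∣-bound {a} {p} = subst (_≤ p) (sym (∣-p∣≡∣p∣ a))

∣-∣-swap : ∀ a b → ∣ a - b ∣ ≡ ∣ b - a ∣
∣-∣-swap a b = trans
  (cong ∣_∣ (solve 2 (λ a b → a :- b := :- (b :- a)) refl a b)) (∣-p∣≡∣p∣ (b - a))

∣-∣-triangle : ∀ a b c → ∣ a - b ∣ ≤ p → ∣ b - c ∣ ≤ q → ∣ a - c ∣ ≤ p + q
∣-∣-triangle {p} {q} a b c ab bc = subst (λ x → ∣ x ∣ ≤ p + q)
  (solve 3 (λ a b c → (a :- b) :+ (b :- c) := a :- c) refl a b c) (∣+∣-bound ab bc)

0≤1/ : ∀ p .{{_ : NonZero p}} → 0ℚ < p → 0ℚ ≤ 1/ p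
0≤1/ (mkℚ ℤ.+[1+ n ] d _) _ = nonNegative⁻¹ (mkℚ ℤ.+[1+ d ] n _)
0≤1/ (mkℚ -[1+ _ ] _ _) (*<* ())

fromℕ : ℕ → ℚ
fromℕ n = + n / 1

fromℕ-mono : m ℕ.≤ n → fromℕ m ≤ fromℕ n
fromℕ-mono {m} {n} m≤n = toℚᵘ-cancel-≤
  (ℚᵘ.≤-respˡ-≃ (ℚᵘ.≃-sym (toℚᵘ-fromℚᵘ (ℚᵘ.mkℚᵘ (+ m) 0)))
  (ℚᵘ.≤-respʳ-≃ (ℚᵘ.≃-sym (toℚᵘ-fromℚᵘ (ℚᵘ.mkℚᵘ (+ n) 0)))
    (ℚᵘ.*≤* (ℤ.*-monoʳ-≤-nonNeg (+ 1) (ℤ.+≤+ m≤n)))))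

fromℕ-nonNeg : ∀ n → 0ℚ ≤ fromℕ n
fromℕ-nonNeg n = fromℕ-mono {0} {n} ℕ.z≤n

fromℕ-* : ∀ m n → fromℕ (m ℕ.* n) ≡ fromℕ m * fromℕ n
fromℕ-* m n = toℚᵘ-injective
  (ℚᵘ.≃-trans (toℚᵘ-fromℚᵘ (ℚᵘ.mkℚᵘ (+ (m ℕ.* n)) 0))
  (ℚᵘ.≃-trans (ℚᵘ.*≡* (cong (ℤ._* + 1) (ℤ.pos-* m n)))
  (ℚᵘ.≃-sym (ℚᵘ.≃-trans (toℚᵘ-homo-* (fromℕ m) (fromℕ n))
    (ℚᵘ.*-cong (toℚᵘ-fromℚᵘ (ℚᵘ.mkℚᵘ (+ m) 0)) (toℚᵘ-fromℚᵘ (ℚᵘ.mkℚᵘ (+ n) 0)))))))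

fromℕ-+ : ∀ m n → fromℕ (m ℕ.+ n) ≡ fromℕ m + fromℕ n
fromℕ-+ m n = toℚᵘ-injective
  (ℚᵘ.≃-trans (toℚᵘ-fromℚᵘ (ℚᵘ.mkℚᵘ (+ (m ℕ.+ n)) 0))
  (ℚᵘ.≃-trans (ℚᵘ.*≡* (cong (ℤ._* + 1) (trans (ℤ.pos-+ m n)
     (sym (cong₂ ℤ._+_ (ℤ.*-identityʳ (+ m)) (ℤ.*-identityʳ (+ n)))))))
  (ℚᵘ.≃-sym (ℚᵘ.≃-trans (toℚᵘ-homo-+ (fromℕ m) (fromℕ n))
    (ℚᵘ.+-cong (toℚᵘ-fromℚᵘ (ℚᵘ.mkℚᵘ (+ m) 0)) (toℚᵘ-fromℚᵘ (ℚᵘ.mkℚᵘ (+ n) 0)))))))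

1/n*n≡1 : ∀ n .{{_ : ℕ.NonZero n}} → (+ 1 / n) * fromℕ n ≡ 1ℚ
1/n*n≡1 (suc n) = toℚᵘ-injective
  (ℚᵘ.≃-trans (toℚᵘ-homo-* (+ 1 / suc n) (fromℕ (suc n)))
  (ℚᵘ.≃-trans (ℚᵘ.*-cong (toℚᵘ-fromℚᵘ (ℚᵘ.mkℚᵘ (+ 1) n)) (toℚᵘ-fromℚᵘ (ℚᵘ.mkℚᵘ (+ suc n) 0)))
    (ℚᵘ.*-inverseˡ (ℚᵘ.mkℚᵘ (+ suc n) 0))))

≤fromℕ : ∀ q → ∃[ n ] q ≤ fromℕ n
≤fromℕ q@(mkℚ i d _) = ℤ.∣ i ∣ , toℚᵘ-cancel-≤
  (ℚᵘ.≤-respʳ-≃ (ℚᵘ.≃-sym (toℚᵘ-fromℚᵘ (ℚᵘ.mkℚᵘ (+ ℤ.∣ i ∣) 0)))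
    (ℚᵘ.*≤* (ℤ.≤-trans (ℤ.≤-reflexive (ℤ.*-identityʳ i)) (lemma i))))
  where
  lemma : ∀ i → i ℤ.≤ + ℤ.∣ i ∣ ℤ.* + suc d
  lemma (+ n)    = subst (+ n ℤ.≤_) (ℤ.pos-* n (suc d)) (ℤ.+≤+ (ℕ.m≤m*n n (suc d)))
  lemma -[1+ n ] = ℤ.-≤+

2^-_ : ℕ → ℚ
2^- zero  = 1ℚ
2^- suc n = ½ * 2^- n

2^-*2^ : ∀ n → 2^- n * fromℕ (2 ℕ.^ n) ≡ 1ℚ
2^-*2^ zero    = refl
2^-*2^ (suc n) = trans (cong (½ * 2^- n *_) (fromℕ-* 2 (2 ℕ.^ n)))
  (trans (solve 2 (λ x y → con ½ :* x :* (con (fromℕ 2) :* y) := x :* y) refl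
            (2^- n) (fromℕ (2 ℕ.^ n)))
         (2^-*2^ n))

2^-nonNeg : ∀ n → 0ℚ ≤ 2^- n
2^-nonNeg zero    = fromℕ-nonNeg 1
2^-nonNeg (suc n) = *-nonNeg {½} (<⇒≤ (positive⁻¹ ½)) (2^-nonNeg n)

½*≤ : 0ℚ ≤ a → ½ * a ≤ a
½*≤ {a} 0≤a = ≤-by (sym (+-identityʳ (½ * a))) (sym (½+½ a))
  (+-monoʳ-≤ (½ * a) (*-nonNeg {½} (<⇒≤ (positive⁻¹ ½)) 0≤a))

2^-antimono : m ℕ.≤ n → 2^- n ≤ 2^- m
2^-antimono {m} {n} m≤n = subst (λ k → 2^- k ≤ 2^- m) (ℕ.m∸n+n≡m m≤n) (go (n ℕ.∸ m))
  where
  go : ∀ k → 2^- (k ℕ.+ m) ≤ 2^- m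
  go zero    = ≤-refl
  go (suc k) = ≤-trans (½*≤ (2^-nonNeg (k ℕ.+ m))) (go k)

archimedean : ∀ K → 0ℚ < ε → ∃[ N ] ∀ {n} → N ℕ.≤ n → fromℕ K * 2^- n ≤ ε
archimedean {ε} K 0<ε = N , λ {n} N≤n → ≤-by
    (solve 2 (λ k h → k :* h := h :* k) refl (fromℕ K) (2^- n))
    (solve 1 (λ e → e := con 1ℚ :* e) refl ε)
    (≤-by refl (cong (_* ε) (sym (2^-*2^ n)))
      (≤-by refl (*-assoc (2^- n) (fromℕ (2 ℕ.^ n)) ε)
        (*-monoˡ-≤-nonNeg (2^- n) {{nonNegative (2^-nonNeg n)}} (bound n N≤n))))
  where
  instance _ = >-nonZero 0<ε
  M N : ℕ
  M = proj₁ (≤fromℕ (1/ ε))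
  N = K ℕ.* M
  n<2^n : ∀ n → n ℕ.< 2 ℕ.^ n
  n<2^n zero    = ℕ.s≤s ℕ.z≤n
  n<2^n (suc n) = ℕ.≤-trans (ℕ.+-mono-≤ (ℕ.≤-trans (ℕ.s≤s ℕ.z≤n) (n<2^n n)) (n<2^n n))
    (ℕ.≤-reflexive (cong (2 ℕ.^ n ℕ.+_) (sym (ℕ.+-identityʳ (2 ℕ.^ n)))))
  1≤M*ε : 1ℚ ≤ fromℕ M * ε
  1≤M*ε = subst (_≤ fromℕ M * ε) (*-inverseˡ ε)
    (*-monoʳ-≤-nonNeg ε {{nonNegative (<⇒≤ 0<ε)}} (proj₂ (≤fromℕ (1/ ε))))
  bound : ∀ n → N ℕ.≤ n → fromℕ K ≤ fromℕ (2 ℕ.^ n) * ε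
  bound n N≤n = ≤-trans
    (≤-by (sym (*-identityʳ (fromℕ K)))
          (trans (cong (_* ε) (fromℕ-* K M)) (*-assoc (fromℕ K) (fromℕ M) ε))
      (*-monoˡ-≤-nonNeg (fromℕ K) {{nonNegative (fromℕ-nonNeg K)}} 1≤M*ε))
    (*-monoʳ-≤-nonNeg ε {{nonNegative (<⇒≤ 0<ε)}}
      (fromℕ-mono (ℕ.≤-trans N≤n (ℕ.<⇒≤ (n<2^n n)))))

IsCauchy : (ℕ → ℚ) → Set
IsCauchy x = ∀ {ε} → 0ℚ < ε → ∃[ N ] ∀ {m n} → N ℕ.≤ m → N ℕ.≤ n → ∣ x m - x n ∣ ≤ ε

record ℝ : Set where
  constructor mkℝ
  field
    seq    : ℕ → ℚ
    cauchy : IsCauchy seq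
open ℝ public

-- The δ makes this closed in the limit, so that ε = 0 gives equality.
∣_-_∣≤_ : ℝ → ℝ → ℚ → Set
∣ x - y ∣≤ ε = ∀ {δ} → 0ℚ < δ → ∃[ N ] ∀ {n} → N ℕ.≤ n → ∣ seq x n - seq y n ∣ ≤ ε + δ

infix 4 _≈ᴿ_
_≈ᴿ_ : ℝ → ℝ → Set
x ≈ᴿ y = ∣ x - y ∣≤ 0ℚ

Posᴿ : ℝ → Set
Posᴿ x = Σ[ ε ∈ ℚ ] 0ℚ < ε × ∃[ N ] ∀ {n} → N ℕ.≤ n → ε ≤ seq x n

constᴿ : ℚ → ℝ
constᴿ q = mkℝ (λ _ → q) λ {ε} 0<ε →
  0 , λ _ _ → subst (λ x → ∣ x ∣ ≤ ε) (sym (+-inverseʳ q)) (<⇒≤ 0<ε)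

infixl 6 _+ᴿ_
_+ᴿ_ : ℝ → ℝ → ℝ
mkℝ x cx +ᴿ mkℝ y cy = mkℝ (λ n → x n + y n) λ {ε} 0<ε →
  let (M , x-close) = cx (½-pos 0<ε)
      (N , y-close) = cy (½-pos 0<ε)
  in M ℕ.⊔ N , λ {m} {n} ≤m ≤n → subst₂ (λ s t → ∣ s ∣ ≤ t)
       (solve 4 (λ a b c d → (a :- b) :+ (c :- d) := (a :+ c) :- (b :+ d)) refl
          (x m) (x n) (y m) (y n))
       (½+½ ε)
       (∣+∣-bound (x-close (ℕ.m⊔n≤o⇒m≤o M N ≤m) (ℕ.m⊔n≤o⇒m≤o M N ≤n))
                  (y-close (ℕ.m⊔n≤o⇒n≤o M N ≤m) (ℕ.m⊔n≤o⇒n≤o M N ≤n)))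

infix 8 -ᴿ_
-ᴿ_ : ℝ → ℝ
-ᴿ mkℝ x cx = mkℝ (λ n → - x n) λ {ε} 0<ε →
  let (N , x-close) = cx 0<ε
  in N , λ {m} {n} ≤m ≤n → subst (λ s → ∣ s ∣ ≤ ε)
       (solve 2 (λ a b → :- (a :- b) := (:- a) :- (:- b)) refl (x m) (x n))
       (∣-∣-bound (x-close ≤m ≤n))

bounded : ∀ x → ∃[ B ] ∃[ N ] ∀ {n} → N ℕ.≤ n → ∣ seq x n ∣ ≤ fromℕ B
bounded (mkℝ x cx) =
  let (N , x-close) = cx (positive⁻¹ 1ℚ)
      (B , ≤B)      = ≤fromℕ (1ℚ + ∣ x N ∣)
  in B , N , λ {n} N≤n → ≤-trans
       (subst (λ s → ∣ s ∣ ≤ 1ℚ + ∣ x N ∣)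
          (solve 2 (λ a b → (a :- b) :+ b := a) refl (x n) (x N))
          (∣+∣-bound (x-close N≤n ℕ.≤-refl) ≤-refl))
       ≤B

shrink : ∀ K → 0ℚ < ε → ∃[ δ ] 0ℚ < δ × fromℕ K * δ ≤ ε
shrink {ε} K 0<ε = ε * (+ 1 / suc K)
  , positive⁻¹ _ {{pos*pos⇒pos ε {{positive 0<ε}} (+ 1 / suc K) {{normalize-pos 1 (suc K)}}}}
  , ≤-by (solve 3 (λ k e i → k :* (e :* i) := e :* (i :* k)) refl (fromℕ K) ε (+ 1 / suc K))
         (trans (sym (*-identityʳ ε)) (cong (ε *_) (sym (1/n*n≡1 (suc K)))))
         (*-monoˡ-≤-nonNeg ε {{nonNegative (<⇒≤ 0<ε)}}
           (*-monoˡ-≤-nonNeg (+ 1 / suc K)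
             {{pos⇒nonNeg (+ 1 / suc K) {{normalize-pos 1 (suc K)}}}}
             (fromℕ-mono (ℕ.n≤1+n K))))

infixl 7 _*ᴿ_
_*ᴿ_ : ℝ → ℝ → ℝ
X@(mkℝ x cx) *ᴿ Y@(mkℝ y cy) = mkℝ (λ n → x n * y n) λ {ε} 0<ε →
  let (A , Nx , x≤A) = bounded X
      (B , Ny , y≤B) = bounded Y
      (δ , 0<δ , small) = shrink (A ℕ.+ B) 0<ε
      (Mx , x-close) = cx 0<δ
      (My , y-close) = cy 0<δ
      N₁ = Nx ℕ.⊔ Ny
      N₂ = Mx ℕ.⊔ My
  in N₁ ℕ.⊔ N₂ , λ {m} {n} ≤m ≤n → ≤-trans
       (subst₂ (λ s t → ∣ s ∣ ≤ t)
         (solve 4 (λ a b c d → a :* (c :- d) :+ (a :- b) :* d := a :* c :- b :* d) refl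
            (x m) (x n) (y m) (y n))
         (trans (solve 3 (λ a b d → a :* d :+ d :* b := (a :+ b) :* d) refl (fromℕ A) (fromℕ B) δ)
                (cong (_* δ) (sym (fromℕ-+ A B))))
         (∣+∣-bound
           (∣*∣-bound (x≤A (ℕ.m⊔n≤o⇒m≤o Nx Ny (ℕ.m⊔n≤o⇒m≤o N₁ N₂ ≤m)))
                      (y-close (ℕ.m⊔n≤o⇒n≤o Mx My (ℕ.m⊔n≤o⇒n≤o N₁ N₂ ≤m))
                               (ℕ.m⊔n≤o⇒n≤o Mx My (ℕ.m⊔n≤o⇒n≤o N₁ N₂ ≤n))))
           (∣*∣-bound (x-close (ℕ.m⊔n≤o⇒m≤o Mx My (ℕ.m⊔n≤o⇒n≤o N₁ N₂ ≤m))
                               (ℕ.m⊔n≤o⇒m≤o Mx My (ℕ.m⊔n≤o⇒n≤o N₁ N₂ ≤n)))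
                      (y≤B (ℕ.m⊔n≤o⇒n≤o Nx Ny (ℕ.m⊔n≤o⇒m≤o N₁ N₂ ≤n))))))
       small

-- Truncating below at the lower bound e makes every term invertible and only alters finitely many of them.
module Reciprocal (x : ℝ) (x>0 : Posᴿ x) where
  e : ℚ
  e = proj₁ x>0

  0<e : 0ℚ < e
  0<e = proj₁ (proj₂ x>0)

  N₀ : ℕ
  N₀ = proj₁ (proj₂ (proj₂ x>0))

  e≤x : N₀ ℕ.≤ n → e ≤ seq x n
  e≤x = proj₂ (proj₂ (proj₂ x>0))

  trunc : ℕ → ℚ
  trunc n = seq x n ⊔ e

  instance
    trunc-pos : ∀ {n} → Positive (trunc n)
    trunc-pos {n} = positive (<-≤-trans 0<e (p≤q⊔p (seq x n) e))
    trunc-nonZero : ∀ {n} → NonZero (trunc n)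
    trunc-nonZero {n} = pos⇒nonZero (trunc n)
    e-nonZero : NonZero e
    e-nonZero = >-nonZero 0<e

  trunc-≡ : N₀ ℕ.≤ n → trunc n ≡ seq x n
  trunc-≡ N₀≤n = p≥q⇒p⊔q≡p (e≤x N₀≤n)

  K : ℕ
  K = proj₁ (≤fromℕ (1/ e))

  0≤1/trunc : ∀ n → 0ℚ ≤ 1/ trunc n
  0≤1/trunc n = 0≤1/ (trunc n) (positive⁻¹ (trunc n))

  1/≤K : ∀ n → ∣ 1/ trunc n ∣ ≤ fromℕ K
  1/≤K n = subst (_≤ fromℕ K) (sym (0≤p⇒∣p∣≡p (0≤1/trunc n)))
    (≤-by (sym (trans (cong (1/ trunc n *_) (*-inverseˡ e)) (*-identityʳ _)))
          (sym (trans (solve 3 (λ i k a → i :* (k :* a) := (i :* a) :* k) refl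
                         (1/ trunc n) (fromℕ K) (trunc n))
                  (trans (cong (_* fromℕ K) (*-inverseˡ (trunc n))) (*-identityˡ _))))
      (*-monoˡ-≤-nonNeg (1/ trunc n) {{nonNegative (0≤1/trunc n)}}
        (*-mono-≤-nonNeg (0≤1/ e 0<e)
          (<⇒≤ (positive⁻¹ (trunc n))) (proj₂ (≤fromℕ (1/ e))) (p≤q⊔p (seq x n) e))))

  1/-diff : ∀ m n → 1/ trunc n * (1/ trunc m * (trunc n - trunc m)) ≡ 1/ trunc m - 1/ trunc n
  1/-diff m n = trans
    (solve 4 (λ i a j b → j :* (i :* (b :- a)) := i :* (j :* b) :- j :* (i :* a)) refl
       (1/ trunc m) (trunc m) (1/ trunc n) (trunc n))
    (cong₂ _-_ (trans (cong (1/ trunc m *_) (*-inverseˡ (trunc n))) (*-identityʳ (1/ trunc m)))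
               (trans (cong (1/ trunc n *_) (*-inverseˡ (trunc m))) (*-identityʳ (1/ trunc n))))

  recip : ℝ
  recip = mkℝ (λ n → 1/ trunc n) λ {η} 0<η →
    let (δ , 0<δ , small) = shrink (K ℕ.* K) 0<η
        (M , x-close)     = cauchy x 0<δ
    in N₀ ℕ.⊔ M , λ {m} {n} ≤m ≤n → ≤-trans
         (subst₂ (λ s t → ∣ s ∣ ≤ t)
           (1/-diff m n)
           (trans (sym (*-assoc (fromℕ K) (fromℕ K) δ)) (cong (_* δ) (sym (fromℕ-* K K))))
           (∣*∣-bound (1/≤K n) (∣*∣-bound (1/≤K m)
             (subst₂ (λ s t → ∣ s - t ∣ ≤ δ)
               (sym (trunc-≡ (ℕ.m⊔n≤o⇒m≤o N₀ M ≤n))) (sym (trunc-≡ (ℕ.m⊔n≤o⇒m≤o N₀ M ≤m)))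
               (x-close (ℕ.m⊔n≤o⇒n≤o N₀ M ≤n) (ℕ.m⊔n≤o⇒n≤o N₀ M ≤m))))))
         small

  recip-inverse : x *ᴿ recip ≈ᴿ constᴿ 1ℚ
  recip-inverse {δ} 0<δ = N₀ , λ {n} N₀≤n →
    subst (λ s → ∣ s - 1ℚ ∣ ≤ 0ℚ + δ)
      (sym (trans (cong (_* 1/ trunc n) (sym (trunc-≡ N₀≤n))) (*-inverseʳ (trunc n))))
      (≤-by refl (+-identityˡ δ) (<⇒≤ 0<δ))

open Reciprocal public using (recip; recip-inverse)

IsCauchyᴿ : (ℕ → ℝ) → Set
IsCauchyᴿ X = ∀ {ε} → 0ℚ < ε → ∃[ N ] ∀ {m n} → N ℕ.≤ m → N ℕ.≤ n → ∣ X m - X n ∣≤ ε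

module Limit (X : ℕ → ℝ) (cX : IsCauchyᴿ X) where
  index : ℕ → ℕ
  index n = proj₁ (cauchy (X n) {2^- n} (2^-pos n))
    where
    2^-pos : ∀ n → 0ℚ < 2^- n
    2^-pos zero    = positive⁻¹ 1ℚ
    2^-pos (suc n) = ½-pos (2^-pos n)

  diagonal : ℕ → ℚ
  diagonal n = seq (X n) (index n)

  diagonal-close : ∀ n {j} → index n ℕ.≤ j → ∣ diagonal n - seq (X n) j ∣ ≤ 2^- n
  diagonal-close n ≤j = proj₂ (cauchy (X n) _) ℕ.≤-refl ≤j

  lim : ℝ
  lim = mkℝ diagonal λ {ε} 0<ε →
    let (M , X-close) = cX (¼-pos 0<ε)
        (N , small)   = archimedean 1 (¼-pos 0<ε)
        2^-≤ε         = λ {n} (N≤n : N ℕ.≤ n) → subst (_≤ ½ * (½ * ε)) (*-identityˡ (2^- n)) (small N≤n)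
    in M ℕ.⊔ N , λ {m} {n} ≤m ≤n →
       let (J , close) = X-close (ℕ.m⊔n≤o⇒m≤o M N ≤m) (ℕ.m⊔n≤o⇒m≤o M N ≤n) (¼-pos 0<ε)
           I = index m ℕ.⊔ index n
           j = J ℕ.⊔ I
           I≤j = ℕ.m≤n⊔m J I
       in ≤-by refl
            (sym (trans (solve 1 (λ e → e :+ (e :+ e) :+ e := e :+ e :+ (e :+ e)) refl (½ * (½ * ε))) (¼+¼+¼+¼ ε)))
            (∣-∣-triangle (diagonal m) (seq (X n) j) (diagonal n)
              (∣-∣-triangle (diagonal m) (seq (X m) j) (seq (X n) j)
                (≤-trans (diagonal-close m (ℕ.m⊔n≤o⇒m≤o (index m) (index n) I≤j))
                         (2^-≤ε (ℕ.m⊔n≤o⇒n≤o M N ≤m)))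
                (close (ℕ.m≤m⊔n J I)))
              (subst (_≤ ½ * (½ * ε)) (∣-∣-swap (diagonal n) (seq (X n) j))
                (≤-trans (diagonal-close n (ℕ.m⊔n≤o⇒n≤o (index m) (index n) I≤j))
                         (2^-≤ε (ℕ.m⊔n≤o⇒n≤o M N ≤n)))))

  lim-converges : ∀ {ε} → 0ℚ < ε → ∃[ N ] ∀ {n} → N ℕ.≤ n → ∣ X n - lim ∣≤ ε
  lim-converges {ε} 0<ε =
    let (N , X-close) = cX 0<ε in
    N , λ {n} N≤n {δ} 0<δ →
      let (M , small) = archimedean 1 (¼-pos 0<δ)
          (L , close) = cauchy (X n) (¼-pos 0<δ)
      in (N ℕ.⊔ M) ℕ.⊔ L , λ {k} ≤k →
        let N≤k = ℕ.m⊔n≤o⇒m≤o N M (ℕ.m⊔n≤o⇒m≤o (N ℕ.⊔ M) L ≤k)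
            M≤k = ℕ.m⊔n≤o⇒n≤o N M (ℕ.m⊔n≤o⇒m≤o (N ℕ.⊔ M) L ≤k)
            L≤k = ℕ.m⊔n≤o⇒n≤o (N ℕ.⊔ M) L ≤k
            (J , Xnk) = X-close N≤n N≤k (½-pos 0<δ)
            I = index k ℕ.⊔ L
            j = J ℕ.⊔ I
            I≤j = ℕ.m≤n⊔m J I
            d = ½ * (½ * δ)
        in ≤-by refl
             (sym (trans (solve 3 (λ d e h → d :+ (e :+ h) :+ d := e :+ (h :+ (d :+ d))) refl d ε (½ * δ))
               (cong (λ t → ε + t) (trans (cong (λ t → ½ * δ + t) (½+½ (½ * δ))) (½+½ δ)))))
             (∣-∣-triangle (seq (X n) k) (seq (X k) j) (diagonal k)
               (∣-∣-triangle (seq (X n) k) (seq (X n) j) (seq (X k) j) (close L≤k (ℕ.m⊔n≤o⇒n≤o (index k) L I≤j)) (Xnk (ℕ.m≤m⊔n J I)))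
               (subst (_≤ d) (∣-∣-swap (diagonal k) (seq (X k) j))
                 (≤-trans (diagonal-close k (ℕ.m⊔n≤o⇒m≤o (index k) L I≤j))
                          (subst (_≤ d) (*-identityˡ (2^- k)) (small M≤k)))))

open Limit public using (lim; lim-converges)

record ℂ : Set where
  constructor _+i_
  field
    re im : ℝ
open ℂ public

infix 4 _≈_
_≈_ : ℂ → ℂ → Set
z ≈ w = re z ≈ᴿ re w × im z ≈ᴿ im w

ι : ℚ → ℂ
ι q = constᴿ q +i constᴿ 0ℚ

infixl 6 _+ᶜ_
_+ᶜ_ : ℂ → ℂ → ℂ
(a +i b) +ᶜ (c +i d) = (a +ᴿ c) +i (b +ᴿ d)

infixl 7 _*ᶜ_
_*ᶜ_ : ℂ → ℂ → ℂ
(a +i b) *ᶜ (c +i d) = (a *ᴿ c +ᴿ -ᴿ (b *ᴿ d)) +i (a *ᴿ d +ᴿ b *ᴿ c)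

infixr 8 _^ᶜ_
_^ᶜ_ : ℂ → ℕ → ℂ
z ^ᶜ zero  = ι 1ℚ
z ^ᶜ suc n = z *ᶜ z ^ᶜ n

∣_∣² : ℂ → ℝ
∣ a +i b ∣² = a *ᴿ a +ᴿ b *ᴿ b

-- Constructively stronger than ¬ (z ≈ ι 0ℚ); the inverse needs a positive lower bound.
infix 4 _#0
_#0 : ℂ → Set
z #0 = Posᴿ ∣ z ∣²

inverse : (z : ℂ) → z #0 → ℂ
inverse z@(a +i b) z#0 = (a *ᴿ recip ∣ z ∣² z#0) +i (-ᴿ b *ᴿ recip ∣ z ∣² z#0)

inverse-correct : ∀ z z#0 → z *ᶜ inverse z z#0 ≈ ι 1ℚ
inverse-correct z z#0 =
    (λ {δ} 0<δ → let (N , close) = recip-inverse ∣ z ∣² z#0 0<δ in N , λ {n} N≤n →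
      subst (λ t → ∣ t - 1ℚ ∣ ≤ 0ℚ + δ)
        (solve 3 (λ a b i → (a :* a :+ b :* b) :* i := a :* (a :* i) :+ (:- (b :* (:- b :* i)))) refl
          (seq (re z) n) (seq (im z) n) (seq (recip ∣ z ∣² z#0) n))
        (close N≤n))
  , (λ {δ} 0<δ → 0 , λ {n} _ →
      subst (λ t → ∣ t - 0ℚ ∣ ≤ 0ℚ + δ)
        (solve 3 (λ a b i → con 0ℚ := a :* (:- b :* i) :+ b :* (a :* i)) refl
          (seq (re z) n) (seq (im z) n) (seq (recip ∣ z ∣² z#0) n))
        (≤-by refl (+-identityˡ δ) (<⇒≤ 0<δ)))

partialSum : (ℕ → ℂ) → ℕ → ℂ
partialSum t zero    = ι 0ℚ
partialSum t (suc n) = partialSum t n +ᶜ t n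

record Summable (t : ℕ → ℂ) : Set where
  field
    re-cauchy : IsCauchyᴿ (λ n → re (partialSum t n))
    im-cauchy : IsCauchyᴿ (λ n → im (partialSum t n))

infinite-sum : (t : ℕ → ℂ) → Summable t → ℂ
infinite-sum t s =
  lim (λ n → re (partialSum t n)) (Summable.re-cauchy s) +i
  lim (λ n → im (partialSum t n)) (Summable.im-cauchy s)

power-term : ℕ → ℂ → ℕ → ℂ
power-term k z n = ι ((-1ℤ ℤ.^ k / n !) {{n !≢0}}) *ᶜ z ^ᶜ n

sin-term cos-term : ℂ → ℕ → ℂ
sin-term z k = power-term k z (2 ℕ.* k ℕ.+ 1)
cos-term z k = power-term k z (2 ℕ.* k)

sums : (ℕ → ℚ) → ℕ → ℚ
sums f zero    = 0ℚ
sums f (suc n) = sums f n + f n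

module GeometricBound (K : ℕ) (f : ℕ → ℚ) (f≤ : ∀ k → ∣ f k ∣ ≤ fromℕ K * 2^- k) where
  tail-+ : ∀ n k → ∣ sums f (k ℕ.+ n) - sums f n ∣ + fromℕ (2 ℕ.* K) * 2^- (k ℕ.+ n)
                   ≤ fromℕ (2 ℕ.* K) * 2^- n
  tail-+ n zero = ≤-reflexive (trans
    (cong (λ t → ∣ t ∣ + fromℕ (2 ℕ.* K) * 2^- n) (+-inverseʳ (sums f n)))
    (+-identityˡ (fromℕ (2 ℕ.* K) * 2^- n)))
  tail-+ n (suc k) = ≤-trans
    (≤-by refl
      (sym (trans (cong (λ t → S + fromℕ K * h + t)
               (trans (cong (_* (½ * h)) (fromℕ-* 2 K))
                 (solve 2 (λ a h → con (fromℕ 2) :* a :* (con ½ :* h) := a :* h) refl (fromℕ K) h)))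
        (trans (solve 3 (λ s a h → s :+ a :* h :+ a :* h := s :+ con (fromℕ 2) :* a :* h) refl S (fromℕ K) h)
          (cong (λ t → S + t * h) (sym (fromℕ-* 2 K))))))
      (+-monoˡ-≤ (fromℕ (2 ℕ.* K) * (½ * h))
        (subst (λ t → ∣ t ∣ ≤ S + fromℕ K * h)
          (solve 3 (λ a b c → (a :- b) :+ c := (a :+ c) :- b) refl
            (sums f (k ℕ.+ n)) (sums f n) (f (k ℕ.+ n)))
          (∣+∣-bound {sums f (k ℕ.+ n) - sums f n} ≤-refl (f≤ (k ℕ.+ n))))))
    (tail-+ n k)
    where
    S = ∣ sums f (k ℕ.+ n) - sums f n ∣
    h = 2^- (k ℕ.+ n)

  tail : n ℕ.≤ m → ∣ sums f m - sums f n ∣ ≤ fromℕ (2 ℕ.* K) * 2^- n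
  tail {n} {m} n≤m = subst (λ m → ∣ sums f m - sums f n ∣ ≤ fromℕ (2 ℕ.* K) * 2^- n)
    (ℕ.m∸n+n≡m n≤m)
    (≤-trans (≤-by (sym (+-identityʳ S)) refl
                (+-monoʳ-≤ S (*-nonNeg (fromℕ-nonNeg (2 ℕ.* K)) (2^-nonNeg k′))))
             (tail-+ n (m ℕ.∸ n)))
    where
    k′ = m ℕ.∸ n ℕ.+ n
    S  = ∣ sums f k′ - sums f n ∣

  close : (∀ {n} → m ℕ.≤ n → fromℕ (2 ℕ.* K) * 2^- n ≤ ε) →
          ∀ {k n} → m ℕ.≤ k → m ℕ.≤ n → ∣ sums f k - sums f n ∣ ≤ ε
  close {ε = ε} small {k} {n} m≤k m≤n with ℕ.≤-total n k
  ... | inj₁ n≤k = ≤-trans (tail n≤k) (small m≤n)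
  ... | inj₂ k≤n = subst (_≤ ε) (∣-∣-swap (sums f n) (sums f k)) (≤-trans (tail k≤n) (small m≤k))

infix 4 _bounds_from_
_bounds_from_ : (ℕ → ℚ) → (ℕ → ℂ) → ℕ → Set
b bounds t from J = ∀ {j} → J ℕ.≤ j → ∀ k → ∣ seq (re (t k)) j ∣ ≤ b k × ∣ seq (im (t k)) j ∣ ≤ b k

summable : ∀ {t} K J → (λ k → fromℕ K * 2^- k) bounds t from J → Summable t
summable {t} K J bound = record
  { re-cauchy = λ {ε} 0<ε → let (N , small) = archimedean (2 ℕ.* K) 0<ε in
      N , λ {m} {n} N≤m N≤n {δ} 0<δ → J , λ {j} J≤j →
        subst₂ (λ s s′ → ∣ s - s′ ∣ ≤ ε + δ) (re-sums j m) (re-sums j n)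
          (weaken 0<δ (GeometricBound.close K _ (λ k → proj₁ (bound J≤j k)) small N≤m N≤n))
  ; im-cauchy = λ {ε} 0<ε → let (N , small) = archimedean (2 ℕ.* K) 0<ε in
      N , λ {m} {n} N≤m N≤n {δ} 0<δ → J , λ {j} J≤j →
        subst₂ (λ s s′ → ∣ s - s′ ∣ ≤ ε + δ) (im-sums j m) (im-sums j n)
          (weaken 0<δ (GeometricBound.close K _ (λ k → proj₂ (bound J≤j k)) small N≤m N≤n))
  }
  where
  weaken : ∀ {a ε δ} → 0ℚ < δ → a ≤ ε → a ≤ ε + δ
  weaken {a} 0<δ a≤ε = ≤-by (sym (+-identityʳ a)) refl (+-mono-≤ a≤ε (<⇒≤ 0<δ))
  re-sums : ∀ j n → sums (λ k → seq (re (t k)) j) n ≡ seq (re (partialSum t n)) j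
  re-sums j zero    = refl
  re-sums j (suc n) = cong (_+ seq (re (t n)) j) (re-sums j n)
  im-sums : ∀ j n → sums (λ k → seq (im (t k)) j) n ≡ seq (im (partialSum t n)) j
  im-sums j zero    = refl
  im-sums j (suc n) = cong (_+ seq (im (t n)) j) (im-sums j n)

*-swap : ∀ a b c → a ℕ.* (b ℕ.* c) ≡ b ℕ.* (a ℕ.* c)
*-swap a b c = trans (sym (ℕ.*-assoc a b c))
  (trans (cong (ℕ._* c) (ℕ.*-comm a b)) (ℕ.*-assoc b a c))

^-distrib-* : ∀ a b n → (a ℕ.* b) ℕ.^ n ≡ a ℕ.^ n ℕ.* b ℕ.^ n
^-distrib-* a b zero    = refl
^-distrib-* a b (suc n) = trans (cong (a ℕ.* b ℕ.*_) (^-distrib-* a b n))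
  (trans (ℕ.*-assoc a b _) (trans (cong (a ℕ.*_) (*-swap b (a ℕ.^ n) (b ℕ.^ n)))
    (sym (ℕ.*-assoc a (a ℕ.^ n) _))))

^≤^*! : ∀ L .{{_ : ℕ.NonZero L}} n → L ℕ.^ n ℕ.≤ L ℕ.^ L ℕ.* n !
^≤^*! L n with ℕ.≤-total n L
... | inj₁ n≤L = ℕ.≤-trans (ℕ.^-monoʳ-≤ L n≤L) (ℕ.m≤m*n (L ℕ.^ L) (n !) {{n !≢0}})
... | inj₂ L≤n = subst (λ n → L ℕ.^ n ℕ.≤ L ℕ.^ L ℕ.* n !) (ℕ.m∸n+n≡m L≤n) (go (n ℕ.∸ L))
  where
  go : ∀ k → L ℕ.^ (k ℕ.+ L) ℕ.≤ L ℕ.^ L ℕ.* (k ℕ.+ L) !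
  go zero    = ℕ.m≤m*n (L ℕ.^ L) (L !) {{L !≢0}}
  go (suc k) = ℕ.≤-trans (ℕ.*-mono-≤ (ℕ.m≤n+m L (suc k)) (go k))
    (ℕ.≤-reflexive (*-swap (suc k ℕ.+ L) (L ℕ.^ L) ((k ℕ.+ L) !)))

∣±1/n∣ : ∀ k n .{{_ : ℕ.NonZero n}} → ∣ -1ℤ ℤ.^ k / n ∣ ≡ + 1 / n
∣±1/n∣ k n with ±1 k
  where
  ±1 : ∀ k → -1ℤ ℤ.^ k ≡ + 1 ⊎ -1ℤ ℤ.^ k ≡ -1ℤ
  ±1 zero = inj₁ refl
  ±1 (suc k) with ±1 k
  ... | inj₁ eq = inj₂ (cong (-1ℤ ℤ.*_) eq)
  ... | inj₂ eq = inj₁ (cong (-1ℤ ℤ.*_) eq)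
... | inj₁ eq rewrite eq = 0≤p⇒∣p∣≡p (nonNegative⁻¹ (+ 1 / n) {{normalize-nonNeg 1 n}})
... | inj₂ eq rewrite eq = trans (∣-p∣≡∣p∣ (+ 1 / n))
  (0≤p⇒∣p∣≡p (nonNegative⁻¹ (+ 1 / n) {{normalize-nonNeg 1 n}}))

module PowerTermBound (z : ℂ) where
  B M L K J : ℕ
  B = suc (proj₁ (bounded (re z)) ℕ.+ proj₁ (bounded (im z)))
  M = 2 ℕ.* B
  L = 2 ℕ.* M
  K = L ℕ.^ L
  J = proj₁ (proj₂ (bounded (re z))) ℕ.⊔ proj₁ (proj₂ (bounded (im z)))

  re≤B : ∀ {j} → J ℕ.≤ j → ∣ seq (re z) j ∣ ≤ fromℕ B
  re≤B J≤j = let (A , N , bound) = bounded (re z) in ≤-trans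
    (bound (ℕ.m⊔n≤o⇒m≤o N _ J≤j)) (fromℕ-mono (ℕ.m≤n⇒m≤1+n (ℕ.m≤m+n A (proj₁ (bounded (im z))))))

  im≤B : ∀ {j} → J ℕ.≤ j → ∣ seq (im z) j ∣ ≤ fromℕ B
  im≤B J≤j = let (A , N , bound) = bounded (im z) in ≤-trans
    (bound (ℕ.m⊔n≤o⇒n≤o _ N J≤j)) (fromℕ-mono (ℕ.m≤n⇒m≤1+n (ℕ.m≤n+m A (proj₁ (bounded (re z))))))

  power-bound : (λ n → fromℕ (M ℕ.^ n)) bounds (z ^ᶜ_) from J
  power-bound J≤j zero    = ≤-refl , fromℕ-nonNeg 1
  power-bound {j} J≤j (suc n) =
    let (re≤ , im≤) = power-bound J≤j n in
      ≤-by refl M^1+n (∣+∣-bound (∣*∣-bound (re≤B J≤j) re≤)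
        (∣-∣-bound {seq (im z) j * seq (im (z ^ᶜ n)) j} (∣*∣-bound (im≤B J≤j) im≤)))
    , ≤-by refl M^1+n (∣+∣-bound (∣*∣-bound (re≤B J≤j) im≤) (∣*∣-bound (im≤B J≤j) re≤))
    where
    P = fromℕ (M ℕ.^ n)
    M^1+n : fromℕ (M ℕ.^ suc n) ≡ fromℕ B * P + fromℕ B * P
    M^1+n = trans (fromℕ-* M (M ℕ.^ n)) (trans (cong (_* P) (fromℕ-* 2 B))
      (solve 2 (λ b p → con (fromℕ 2) :* b :* p := b :* p :+ b :* p) refl (fromℕ B) P))

  M^n/n!≤ : ∀ n → (+ 1 / n !) {{n !≢0}} * fromℕ (M ℕ.^ n) ≤ fromℕ K * 2^- n
  M^n/n!≤ n = ≤-by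
    (trans (sym (trans (cong (i * P *_) (2^-*2^ n)) (*-identityʳ (i * P))))
      (trans (solve 4 (λ i p h t → i :* p :* (h :* t) := h :* i :* (t :* p)) refl i P h T)
        (cong (h * i *_) (trans (sym (fromℕ-* (2 ℕ.^ n) (M ℕ.^ n)))
          (cong fromℕ (sym (^-distrib-* 2 M n)))))))
    (sym (trans (cong (h * i *_) (fromℕ-* K (n !)))
      (trans (solve 4 (λ k f h i → h :* i :* (k :* f) := k :* h :* (i :* f)) refl (fromℕ K) F h i)
      (trans (cong (fromℕ K * h *_) (1/n*n≡1 (n !) {{n !≢0}})) (*-identityʳ (fromℕ K * h))))))
    (*-monoˡ-≤-nonNeg (h * i) {{nonNegative (*-nonNeg (2^-nonNeg n) 0≤i)}} (fromℕ-mono (^≤^*! L n)))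
    where
    i = (+ 1 / n !) {{n !≢0}}
    P = fromℕ (M ℕ.^ n)
    F = fromℕ (n !)
    T = fromℕ (2 ℕ.^ n)
    h = 2^- n
    0≤i : 0ℚ ≤ i
    0≤i = nonNegative⁻¹ i {{normalize-nonNeg 1 (n !) {{n !≢0}}}}

  term-bound : ∀ (e : ℕ → ℕ) → (∀ k → k ℕ.≤ e k) →
    (λ k → fromℕ K * 2^- k) bounds (λ k → power-term k z (e k)) from J
  term-bound e k≤e {j} J≤j k =
    let (re≤ , im≤) = power-bound J≤j (e k) in
      ≤-trans (≤-by refl (sym cp+0) (∣+∣-bound (∣*∣-bound c≤i re≤)
        (∣-∣-bound {0ℚ * seq (im (z ^ᶜ e k)) j} (∣*∣-bound {0ℚ} ≤-refl im≤)))) small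
    , ≤-trans (≤-by refl (sym cp+0) (∣+∣-bound (∣*∣-bound c≤i im≤) (∣*∣-bound {0ℚ} ≤-refl re≤))) small
    where
    i = (+ 1 / e k !) {{e k !≢0}}
    P = fromℕ (M ℕ.^ e k)
    c≤i : ∣ (-1ℤ ℤ.^ k / e k !) {{e k !≢0}} ∣ ≤ i
    c≤i = ≤-reflexive (∣±1/n∣ k (e k !) {{e k !≢0}})
    cp+0 : i * P + 0ℚ * P ≡ i * P
    cp+0 = solve 2 (λ i p → i :* p :+ con 0ℚ :* p := i :* p) refl i P
    small : i * P ≤ fromℕ K * 2^- k
    small = ≤-trans (M^n/n!≤ (e k))
      (*-monoˡ-≤-nonNeg (fromℕ K) {{nonNegative (fromℕ-nonNeg K)}} (2^-antimono (k≤e k)))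

sin-summable : ∀ z → Summable (sin-term z)
sin-summable z = summable K J
  (term-bound (λ k → 2 ℕ.* k ℕ.+ 1) λ k → ℕ.≤-trans (ℕ.m≤m+n k _) (ℕ.m≤m+n (2 ℕ.* k) 1))
  where open PowerTermBound z

cos-summable : ∀ z → Summable (cos-term z)
cos-summable z = summable K J (term-bound (2 ℕ.*_) λ k → ℕ.m≤m+n k _)
  where open PowerTermBound z

sin cos : ℂ → ℂ
sin z = infinite-sum (sin-term z) (sin-summable z)
cos z = infinite-sum (cos-term z) (cos-summable z)

tan : (z : ℂ) → cos z #0 → ℂ
tan z cos≠0 = sin z *ᶜ inverse (cos z) cos≠0

Rational : ℂ → Set
Rational z = ∃[ q ] z ≈ ι q

{-# OPTIONS --safe #-}
module Submission where

-- Put x = -s = a/b and F n = Σ xᵏ / (2ᵏ k! (2n+2k-1)!!). Then cos r = F 0, sin r = r · F 1, and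
-- F n = (2n+1) F (n+1) + x F (n+2). A linear form v F n + z F (n+1) with integer coefficients, once
-- multiplied by b, is therefore a form v⁺ F (n+1) + z⁺ F (n+2) with z⁺ = a v. Since |v| cannot
-- decrease strictly for ever, a step with |v| ≤ |v⁺| occurs at arbitrarily large n, and there the first
-- term dominates, because F (n+1) / F n is about 1/(2n+1). So no nontrivial form in F 0 and F 1
-- vanishes. This yields an explicit positive lower bound, as needed for cos r #0, and rules out
-- the relation s F 1 = ρ F 0 that r tan r = ρ would give.

open import Defs
open import Data.Integer.Base as ℤ using (ℤ; +_; -[1+_]; -1ℤ)
import Data.Integer.Properties as ℤ
open import Data.Nat.Base as ℕ using (ℕ; zero; suc; _!)
import Data.Nat.Properties as ℕ
open import Data.Nat.Properties using (_!≢0)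
open import Data.Product.Base using (Σ-syntax; ∃-syntax; _×_; _,_; proj₁; proj₂)
open import Data.Rational.Base
open import Data.Rational.Properties
open import Data.Rational.Solver using (module +-*-Solver)
import Data.Rational.Unnormalised.Base as ℚᵘ
import Data.Rational.Unnormalised.Properties as ℚᵘ
open import Data.Sum.Base using (inj₁; inj₂)
open import Relation.Binary.Bundles using (Setoid)
open import Relation.Binary.PropositionalEquality
  using (_≡_; _≢_; refl; sym; trans; cong; cong₂; subst; subst₂; module ≡-Reasoning)
open import Relation.Nullary.Decidable using (Dec; yes; no)
open import Relation.Nullary.Negation using (¬_; contradiction)

open +-*-Solver using (solve; _:=_; _:+_; _:*_; _:-_; :-_; con)

-- Integers as rationals, and clearing of denominators

fromℤ : ℤ → ℚ
fromℤ i = i / 1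

toℚᵘ-fromℤ : ∀ i → toℚᵘ (fromℤ i) ℚᵘ.≃ ℚᵘ.mkℚᵘ i 0
toℚᵘ-fromℤ i = toℚᵘ-fromℚᵘ (ℚᵘ.mkℚᵘ i 0)

fromℤ-* : ∀ i j → fromℤ (i ℤ.* j) ≡ fromℤ i * fromℤ j
fromℤ-* i j = toℚᵘ-injective (ℚᵘ.≃-trans (toℚᵘ-fromℤ (i ℤ.* j))
  (ℚᵘ.≃-sym (ℚᵘ.≃-trans (toℚᵘ-homo-* (fromℤ i) (fromℤ j))
    (ℚᵘ.*-cong (toℚᵘ-fromℤ i) (toℚᵘ-fromℤ j)))))

fromℤ-+ : ∀ i j → fromℤ (i ℤ.+ j) ≡ fromℤ i + fromℤ j
fromℤ-+ i j = toℚᵘ-injective (ℚᵘ.≃-trans (toℚᵘ-fromℤ (i ℤ.+ j))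
  (ℚᵘ.≃-trans (ℚᵘ.*≡* (cong (ℤ._* + 1)
    (sym (cong₂ ℤ._+_ (ℤ.*-identityʳ i) (ℤ.*-identityʳ j)))))
  (ℚᵘ.≃-sym (ℚᵘ.≃-trans (toℚᵘ-homo-+ (fromℤ i) (fromℤ j))
    (ℚᵘ.+-cong (toℚᵘ-fromℤ i) (toℚᵘ-fromℤ j))))))

∣fromℤ∣ : ∀ i → ∣ fromℤ i ∣ ≡ fromℕ ℤ.∣ i ∣
∣fromℤ∣ (+ n)    = 0≤p⇒∣p∣≡p (fromℕ-nonNeg n)
∣fromℤ∣ -[1+ n ] = trans (∣-p∣≡∣p∣ (fromℕ (suc n))) (0≤p⇒∣p∣≡p (fromℕ-nonNeg (suc n)))

*-↧≡↥ : ∀ p → p * fromℕ (↧ₙ p) ≡ fromℤ (↥ p)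
*-↧≡↥ p@record{} = toℚᵘ-injective
  (ℚᵘ.≃-trans (toℚᵘ-homo-* p (fromℕ (↧ₙ p)))
  (ℚᵘ.≃-trans (ℚᵘ.*-congˡ {toℚᵘ p} (toℚᵘ-fromℤ (↧ p)))
  (ℚᵘ.≃-trans (ℚᵘ.*≡* (trans (ℤ.*-assoc (↥ p) (↧ p) (+ 1))
                        (cong (λ d → ↥ p ℤ.* d) (trans (ℤ.*-identityʳ (↧ p)) (cong +_ (sym (ℕ.*-identityʳ (↧ₙ p))))))))
    (ℚᵘ.≃-sym (toℚᵘ-fromℤ (↥ p))))))

-- Coefficients of the series `F n`

infixr 8 _^_
_^_ : ℚ → ℕ → ℚ
x ^ zero  = 1ℚ
x ^ suc k = x * x ^ k

odd : ℕ → ℕ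
odd n = suc (2 ℕ.* n)

fromℕ-odd : ∀ n → fromℕ (odd n) ≡ 1ℚ + fromℕ 2 * fromℕ n
fromℕ-odd n = trans (fromℕ-+ 1 (2 ℕ.* n)) (cong (λ t → 1ℚ + t) (fromℕ-* 2 n))

fromℕ-odd-+ : ∀ n k → fromℕ (odd (n ℕ.+ k)) ≡ fromℕ (odd n) + fromℕ 2 * fromℕ k
fromℕ-odd-+ n k = begin
  fromℕ (odd (n ℕ.+ k))                         ≡⟨ fromℕ-odd (n ℕ.+ k) ⟩
  1ℚ + fromℕ 2 * fromℕ (n ℕ.+ k)                ≡⟨ cong (λ t → 1ℚ + fromℕ 2 * t) (fromℕ-+ n k) ⟩
  1ℚ + fromℕ 2 * (fromℕ n + fromℕ k)
    ≡⟨ solve 3 (λ a n k → con 1ℚ :+ a :* (n :+ k) := con 1ℚ :+ a :* n :+ a :* k) refl (fromℕ 2) (fromℕ n) (fromℕ k) ⟩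
  1ℚ + fromℕ 2 * fromℕ n + fromℕ 2 * fromℕ k    ≡⟨ cong (_+ fromℕ 2 * fromℕ k) (fromℕ-odd n) ⟨
  fromℕ (odd n) + fromℕ 2 * fromℕ k             ∎
  where open ≡-Reasoning

-- 1 / (2ᵏ k! (2n+2k-1)!!)
coeff : ℕ → ℕ → ℚ
coeff n       (suc k) = + 1 / (2 ℕ.* suc k) * coeff (suc n) k
coeff (suc n) zero    = + 1 / odd n * coeff n zero
coeff zero    zero    = 1ℚ

-- Raising `n` by one lengthens the double factorial by the single factor `2(n+k)+1` and changes
-- nothing else in the closed form.
coeff-step : ∀ n k → coeff n k ≡ fromℕ (odd (n ℕ.+ k)) * coeff (suc n) k
coeff-step n zero = begin
  coeff n 0                                       ≡⟨ *-identityˡ (coeff n 0) ⟨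
  1ℚ * coeff n 0                                  ≡⟨ cong (_* coeff n 0) (1/n*n≡1 (odd n)) ⟨
  + 1 / odd n * fromℕ (odd n) * coeff n 0
    ≡⟨ solve 3 (λ i a c → i :* a :* c := a :* (i :* c)) refl (+ 1 / odd n) (fromℕ (odd n)) (coeff n 0) ⟩
  fromℕ (odd n) * coeff (suc n) 0
    ≡⟨ cong (λ m → fromℕ (odd m) * coeff (suc n) 0) (ℕ.+-identityʳ n) ⟨
  fromℕ (odd (n ℕ.+ 0)) * coeff (suc n) 0         ∎
  where open ≡-Reasoning
coeff-step n (suc k) = begin
  i * coeff (suc n) k                              ≡⟨ cong (i *_) (coeff-step (suc n) k) ⟩
  i * (fromℕ (odd (suc n ℕ.+ k)) * coeff (2 ℕ.+ n) k)
    ≡⟨ solve 3 (λ i a c → i :* (a :* c) := a :* (i :* c)) refl i (fromℕ (odd (suc n ℕ.+ k))) (coeff (2 ℕ.+ n) k) ⟩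
  fromℕ (odd (suc n ℕ.+ k)) * coeff (suc n) (suc k)
    ≡⟨ cong (λ m → fromℕ (odd m) * coeff (suc n) (suc k)) (ℕ.+-suc n k) ⟨
  fromℕ (odd (n ℕ.+ suc k)) * coeff (suc n) (suc k) ∎
  where
  open ≡-Reasoning
  i = + 1 / (2 ℕ.* suc k)

half-inverse : ∀ k → + 1 / (2 ℕ.* suc k) * (fromℕ 2 * fromℕ (suc k)) ≡ 1ℚ
half-inverse k = trans (cong (+ 1 / (2 ℕ.* suc k) *_) (sym (fromℕ-* 2 (suc k))))
  (1/n*n≡1 (2 ℕ.* suc k))

-- Split the factor `2(n+k+1)+1` supplied by `coeff-step` as `(2n+1) + 2(k+1)`. The second summand
-- cancels the `1 / (2(k+1))` inside `coeff (suc n) (suc k)` and leaves `coeff (2 ℕ.+ n) k`.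
-- Coefficient by coefficient, this is the recurrence for `F`.
coeff-rec : ∀ n k → coeff n (suc k) ≡
  fromℕ (odd n) * coeff (suc n) (suc k) + coeff (2 ℕ.+ n) k
coeff-rec n k = begin
  coeff n (suc k)                                 ≡⟨ coeff-step n (suc k) ⟩
  fromℕ (odd (n ℕ.+ suc k)) * (i * c)             ≡⟨ cong (_* (i * c)) (fromℕ-odd-+ n (suc k)) ⟩
  (o + fromℕ 2 * fromℕ (suc k)) * (i * c)
    ≡⟨ solve 4 (λ o t i c → (o :+ t) :* (i :* c) := o :* (i :* c) :+ i :* t :* c) refl
        o (fromℕ 2 * fromℕ (suc k)) i c ⟩
  o * (i * c) + i * (fromℕ 2 * fromℕ (suc k)) * c ≡⟨ cong (λ t → o * (i * c) + t * c) (half-inverse k) ⟩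
  o * (i * c) + 1ℚ * c                            ≡⟨ cong (λ t → o * (i * c) + t) (*-identityˡ c) ⟩
  o * (i * c) + c                                 ∎
  where
  open ≡-Reasoning
  i = + 1 / (2 ℕ.* suc k)
  o = fromℕ (odd n)
  c = coeff (2 ℕ.+ n) k

-- Since `2ᵏ k! (2k-1)!! = (2k)!` and `2ᵏ k! (2k+1)!! = (2k+1)!`, the series `F 0` and `F 1` carry
-- the unsigned Taylor coefficients of cosine and sine. The induction alternates: sine at `k` rests
-- on cosine at `k`, cosine at `suc k` on sine at `k`.
coeff-cos : ∀ k → coeff 0 k * fromℕ ((2 ℕ.* k) !) ≡ 1ℚ
coeff-sin : ∀ k → coeff 1 k * fromℕ ((odd k) !) ≡ 1ℚ

coeff-cos zero    = refl
coeff-cos (suc k) = begin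
  i * c * fromℕ ((2 ℕ.* suc k) !)                 ≡⟨ cong (λ m → i * c * fromℕ (m !)) (ℕ.*-suc 2 k) ⟩
  i * c * fromℕ ((2 ℕ.+ 2 ℕ.* k) !)
    ≡⟨ cong (i * c *_) (fromℕ-* (2 ℕ.+ 2 ℕ.* k) ((odd k) !)) ⟩
  i * c * (fromℕ (2 ℕ.+ 2 ℕ.* k) * f)             ≡⟨ cong (λ m → i * c * (fromℕ m * f)) (ℕ.*-suc 2 k) ⟨
  i * c * (fromℕ (2 ℕ.* suc k) * f)
    ≡⟨ solve 4 (λ i c t f → i :* c :* (t :* f) := i :* t :* (c :* f)) refl
        i c (fromℕ (2 ℕ.* suc k)) f ⟩
  i * fromℕ (2 ℕ.* suc k) * (c * f)               ≡⟨ cong₂ _*_ (1/n*n≡1 (2 ℕ.* suc k)) (coeff-sin k) ⟩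
  1ℚ * 1ℚ                                         ∎
  where
  open ≡-Reasoning
  i = + 1 / (2 ℕ.* suc k)
  c = coeff 1 k
  f = fromℕ ((odd k) !)

coeff-sin k = begin
  coeff 1 k * fromℕ ((odd k) !)
    ≡⟨ cong (coeff 1 k *_) (fromℕ-* (odd k) ((2 ℕ.* k) !)) ⟩
  coeff 1 k * (fromℕ (odd k) * f)
    ≡⟨ solve 3 (λ c o f → c :* (o :* f) := o :* c :* f) refl (coeff 1 k) (fromℕ (odd k)) f ⟩
  fromℕ (odd k) * coeff 1 k * f                   ≡⟨ cong (_* f) (coeff-step 0 k) ⟨
  coeff 0 k * f                                   ≡⟨ coeff-cos k ⟩
  1ℚ                                              ∎
  where
  open ≡-Reasoning
  f = fromℕ ((2 ℕ.* k) !)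

0≤1/ℕ : ∀ n .{{_ : ℕ.NonZero n}} → 0ℚ ≤ + 1 / n
0≤1/ℕ n = nonNegative⁻¹ (+ 1 / n) {{normalize-nonNeg 1 n}}

coeff-nonNeg : ∀ n k → 0ℚ ≤ coeff n k
coeff-nonNeg n       (suc k) = *-nonNeg (0≤1/ℕ (2 ℕ.* suc k)) (coeff-nonNeg (suc n) k)
coeff-nonNeg (suc n) zero    = *-nonNeg (0≤1/ℕ (odd n)) (coeff-nonNeg n zero)
coeff-nonNeg zero    zero    = fromℕ-nonNeg 1

coeff-pos : ∀ n → 0ℚ < coeff n 0
coeff-pos zero    = positive⁻¹ 1ℚ
coeff-pos (suc n) = positive⁻¹ _
  {{pos*pos⇒pos (+ 1 / odd n) {{normalize-pos 1 (odd n)}} (coeff n 0) {{positive (coeff-pos n)}}}}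

coeff-zero≤1 : ∀ n → coeff n 0 ≤ 1ℚ
coeff-zero≤1 zero    = ≤-refl
coeff-zero≤1 (suc n) = ≤-trans
  (≤-by (sym (*-identityˡ (coeff (suc n) 0)))
        (trans (coeff-step n 0) (cong (λ m → fromℕ (odd m) * coeff (suc n) 0) (ℕ.+-identityʳ n)))
     (*-monoʳ-≤-nonNeg (coeff (suc n) 0) {{nonNegative (coeff-nonNeg (suc n) 0)}}
       (fromℕ-mono {1} {odd n} (ℕ.s≤s ℕ.z≤n))))
  (coeff-zero≤1 n)

-- Passing to `suc k`, the factorial gains `k+1` and the coefficient `1 / (2(k+1))`, so the product
-- is halved each time, down to some `coeff m 0 ≤ 1`.
coeff*!≤1 : ∀ n k → coeff n k * fromℕ (k !) ≤ 1ℚ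
coeff*!≤1 n zero    = ≤-by (*-identityʳ (coeff n 0)) refl (coeff-zero≤1 n)
coeff*!≤1 n (suc k) = ≤-trans (≤-by eq refl (½*≤ (*-nonNeg (coeff-nonNeg (suc n) k) (fromℕ-nonNeg (k !)))))
  (coeff*!≤1 (suc n) k)
  where
  open ≡-Reasoning
  i = + 1 / (2 ℕ.* suc k)
  c = coeff (suc n) k
  f = fromℕ (k !)
  s = fromℕ (suc k)
  eq : i * c * fromℕ (suc k !) ≡ ½ * (c * f)
  eq = begin
    i * c * fromℕ (suc k !)            ≡⟨ cong (i * c *_) (fromℕ-* (suc k) (k !)) ⟩
    i * c * (s * f)
      ≡⟨ solve 4 (λ i c s f → i :* c :* (s :* f) := i :* (con (fromℕ 2) :* s) :* (con ½ :* (c :* f))) refl i c s f ⟩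
    i * (fromℕ 2 * s) * (½ * (c * f))  ≡⟨ cong (_* (½ * (c * f))) (half-inverse k) ⟩
    1ℚ * (½ * (c * f))                 ≡⟨ *-identityˡ (½ * (c * f)) ⟩
    ½ * (c * f)                        ∎

-- The series `F n`: convergence, recurrence, leading term

∣^∣-bound : ∀ {x} M → ∣ x ∣ ≤ fromℕ M → ∀ k → ∣ x ^ k ∣ ≤ fromℕ (M ℕ.^ k)
∣^∣-bound M x≤M zero    = ≤-refl
∣^∣-bound {x} M x≤M (suc k) = ≤-by refl (fromℕ-* M (M ℕ.^ k))
  (∣*∣-bound {x} x≤M (∣^∣-bound M x≤M k))

-- Each term is at most a third of the one before, so everything after the first sums to at most
-- `1/3 + 1/9 + ... = 1/2` of it.
geometric-close : ∀ (f : ℕ → ℚ) → (∀ k → fromℕ 3 * ∣ f (suc k) ∣ ≤ ∣ f k ∣) →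
  ∀ m → ∣ sums f (suc m) - f 0 ∣ ≤ ½ * ∣ f 0 ∣
geometric-close f ratio m = ≤-trans
  (≤-by (sym (+-identityʳ ∣ sums f (suc m) - f 0 ∣)) refl
    (+-monoʳ-≤ ∣ sums f (suc m) - f 0 ∣ (*-nonNeg {½} (<⇒≤ (positive⁻¹ ½)) (0≤∣p∣ (f m)))))
  (potential m)
  where
  open ≤-Reasoning
  -- The added half of the last term is the allowance for the tail still to come; with it the
  -- induction closes.
  potential : ∀ m → ∣ sums f (suc m) - f 0 ∣ + ½ * ∣ f m ∣ ≤ ½ * ∣ f 0 ∣
  potential zero = ≤-reflexive (trans
    (cong (λ t → ∣ t ∣ + ½ * ∣ f 0 ∣) (solve 1 (λ a → con 0ℚ :+ a :- a := con 0ℚ) refl (f 0)))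
    (+-identityˡ (½ * ∣ f 0 ∣)))
  potential (suc m) = begin
    ∣ s + u - f 0 ∣ + ½ * ∣ u ∣
      ≡⟨ cong (λ t → ∣ t ∣ + ½ * ∣ u ∣) (solve 3 (λ s u a → s :+ u :- a := s :- a :+ u) refl s u (f 0)) ⟩
    ∣ s - f 0 + u ∣ + ½ * ∣ u ∣            ≤⟨ +-monoˡ-≤ (½ * ∣ u ∣) (∣p+q∣≤∣p∣+∣q∣ (s - f 0) u) ⟩
    ∣ s - f 0 ∣ + ∣ u ∣ + ½ * ∣ u ∣
      ≡⟨ solve 2 (λ d u → d :+ u :+ con ½ :* u := d :+ con ½ :* (con (fromℕ 3) :* u)) refl ∣ s - f 0 ∣ ∣ u ∣ ⟩
    ∣ s - f 0 ∣ + ½ * (fromℕ 3 * ∣ u ∣)    ≤⟨ +-monoʳ-≤ ∣ s - f 0 ∣ (*-monoˡ-≤-nonNeg ½ (ratio m)) ⟩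
    ∣ s - f 0 ∣ + ½ * ∣ f m ∣              ≤⟨ potential m ⟩
    ½ * ∣ f 0 ∣                            ∎
    where
    s = sums f (suc m)
    u = f (suc m)

module Series (x : ℚ) where
  term : ℕ → ℕ → ℚ
  term n k = coeff n k * x ^ k

  private
    M K : ℕ
    -- `suc` makes `2 ℕ.* M` nonzero, as `^≤^*!` requires; that lemma then gives `(2M)ᵏ ≤ K k!`.
    M = suc (proj₁ (≤fromℕ ∣ x ∣))
    K = (2 ℕ.* M) ℕ.^ (2 ℕ.* M)

  -- Inserting `1 = 2^- k * 2ᵏ` turns `Mᵏ` into `(2M)ᵏ ≤ K k!`, and `coeff*!≤1` absorbs the
  -- factorial.
  ∣term∣≤ : ∀ n k → ∣ term n k ∣ ≤ fromℕ K * 2^- k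
  ∣term∣≤ n k = begin
    ∣ c * x ^ k ∣
      ≤⟨ ∣*∣-bound {c} (≤-reflexive (0≤p⇒∣p∣≡p (coeff-nonNeg n k))) (∣^∣-bound M ∣x∣≤M k) ⟩
    c * fromℕ (M ℕ.^ k)                         ≡⟨ *-identityʳ (c * fromℕ (M ℕ.^ k)) ⟨
    c * fromℕ (M ℕ.^ k) * 1ℚ                    ≡⟨ cong (c * fromℕ (M ℕ.^ k) *_) (2^-*2^ k) ⟨
    c * fromℕ (M ℕ.^ k) * (h * fromℕ (2 ℕ.^ k))
      ≡⟨ solve 4 (λ c m h t → c :* m :* (h :* t) := c :* h :* (t :* m)) refl
          c (fromℕ (M ℕ.^ k)) h (fromℕ (2 ℕ.^ k)) ⟩
    c * h * (fromℕ (2 ℕ.^ k) * fromℕ (M ℕ.^ k))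
      ≡⟨ cong (c * h *_) (trans (sym (fromℕ-* (2 ℕ.^ k) (M ℕ.^ k))) (cong fromℕ (sym (^-distrib-* 2 M k)))) ⟩
    c * h * fromℕ ((2 ℕ.* M) ℕ.^ k)
      ≤⟨ *-monoˡ-≤-nonNeg (c * h) {{nonNegative (*-nonNeg (coeff-nonNeg n k) (2^-nonNeg k))}}
          (fromℕ-mono (^≤^*! (2 ℕ.* M) k)) ⟩
    c * h * fromℕ (K ℕ.* k !)                   ≡⟨ cong (c * h *_) (fromℕ-* K (k !)) ⟩
    c * h * (fromℕ K * fromℕ (k !))
      ≡⟨ solve 4 (λ c h a f → c :* h :* (a :* f) := a :* h :* (c :* f)) refl c h (fromℕ K) (fromℕ (k !)) ⟩
    fromℕ K * h * (c * fromℕ (k !))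
      ≤⟨ *-monoˡ-≤-nonNeg (fromℕ K * h) {{nonNegative (*-nonNeg (fromℕ-nonNeg K) (2^-nonNeg k))}} (coeff*!≤1 n k) ⟩
    fromℕ K * h * 1ℚ                            ≡⟨ *-identityʳ (fromℕ K * h) ⟩
    fromℕ K * h                                 ∎
    where
    open ≤-Reasoning
    c = coeff n k
    h = 2^- k
    ∣x∣≤M : ∣ x ∣ ≤ fromℕ M
    ∣x∣≤M = ≤-trans (proj₂ (≤fromℕ ∣ x ∣)) (fromℕ-mono (ℕ.n≤1+n (proj₁ (≤fromℕ ∣ x ∣))))

  F : ℕ → ℝ
  F n = mkℝ (sums (term n)) λ 0<ε →
    let (N , small) = archimedean (2 ℕ.* K) 0<ε
    in N , GeometricBound.close K (term n) (∣term∣≤ n) small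

  -- The recurrence is exact on partial sums if `F (2 ℕ.+ n)` gets one term fewer, because the
  -- factor `x` raises its degree by one.
  sums-rec : ∀ n m → sums (term n) (suc m) ≡
    fromℕ (odd n) * sums (term (suc n)) (suc m) + x * sums (term (2 ℕ.+ n)) m
  sums-rec n zero = begin
    0ℚ + coeff n 0 * 1ℚ                      ≡⟨ cong (λ t → 0ℚ + t * 1ℚ) (coeff-step n 0) ⟩
    0ℚ + fromℕ (odd (n ℕ.+ 0)) * c * 1ℚ
      ≡⟨ cong (λ m → 0ℚ + fromℕ (odd m) * c * 1ℚ) (ℕ.+-identityʳ n) ⟩
    0ℚ + fromℕ (odd n) * c * 1ℚ
      ≡⟨ solve 3 (λ o c x → con 0ℚ :+ o :* c :* con 1ℚ := o :* (con 0ℚ :+ c :* con 1ℚ) :+ x :* con 0ℚ) refl (fromℕ (odd n)) c x ⟩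
    fromℕ (odd n) * (0ℚ + c * 1ℚ) + x * 0ℚ   ∎
    where
    open ≡-Reasoning
    c = coeff (suc n) 0
  sums-rec n (suc m) = begin
    sums (term n) (suc m) + coeff n (suc m) * (x * y)
      ≡⟨ cong₂ (λ s t → s + t * (x * y)) (sums-rec n m) (coeff-rec n m) ⟩
    o * s + x * t + (o * c + d) * (x * y)
      ≡⟨ solve 7 (λ o s x t c d y → o :* s :+ x :* t :+ (o :* c :+ d) :* (x :* y)
          := o :* (s :+ c :* (x :* y)) :+ x :* (t :+ d :* y)) refl o s x t c d y ⟩
    o * (s + c * (x * y)) + x * (t + d * y)               ∎
    where
    open ≡-Reasoning
    o = fromℕ (odd n)
    s = sums (term (suc n)) (suc m)
    t = sums (term (2 ℕ.+ n)) m
    c = coeff (suc n) (suc m)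
    d = coeff (2 ℕ.+ n) m
    y = x ^ m

  module LeadingTerm (A : ℕ) (∣x∣≤A : ∣ x ∣ ≤ fromℕ A) {n : ℕ} (6A≤odd : 6 ℕ.* A ℕ.≤ odd n) where
    open ≤-Reasoning

    -- Consecutive terms have quotient `x / (2(k+1)(2n+2k+1))`. Its size is at most `A / (2n+2k+1)`,
    -- hence at most `1/3` for such `n`.
    ratio : ∀ k → fromℕ 3 * ∣ term n (suc k) ∣ ≤ ∣ term n k ∣
    ratio k = begin
      fromℕ 3 * ∣ i * c * (x * y) ∣
        ≡⟨ cong (λ t → fromℕ 3 * ∣ t ∣) (solve 4 (λ i c x y → i :* c :* (x :* y) := i :* x :* (c :* y)) refl i c x y) ⟩
      fromℕ 3 * ∣ i * x * (c * y) ∣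
        ≤⟨ *-monoˡ-≤-nonNeg (fromℕ 3) (∣*∣-bound {i * x} (∣*∣-bound {i} ∣i∣≤1 ∣x∣≤A) ≤-refl) ⟩
      fromℕ 3 * (1ℚ * fromℕ A * ∣ w ∣)
        ≡⟨ solve 3 (λ t a w → t :* (con 1ℚ :* a :* w) := t :* a :* w) refl (fromℕ 3) (fromℕ A) ∣ w ∣ ⟩
      fromℕ 3 * fromℕ A * ∣ w ∣                  ≡⟨ cong (_* ∣ w ∣) (fromℕ-* 3 A) ⟨
      fromℕ (3 ℕ.* A) * ∣ w ∣
        ≤⟨ *-monoʳ-≤-nonNeg ∣ w ∣ {{∣-∣-nonNeg w}} (fromℕ-mono 3A≤odd) ⟩
      fromℕ (odd (n ℕ.+ k)) * ∣ w ∣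
        ≡⟨ cong (_* ∣ w ∣) (0≤p⇒∣p∣≡p (fromℕ-nonNeg (odd (n ℕ.+ k)))) ⟨
      ∣ fromℕ (odd (n ℕ.+ k)) ∣ * ∣ w ∣          ≡⟨ ∣p*q∣≡∣p∣*∣q∣ (fromℕ (odd (n ℕ.+ k))) w ⟨
      ∣ fromℕ (odd (n ℕ.+ k)) * (c * y) ∣        ≡⟨ cong ∣_∣ (*-assoc (fromℕ (odd (n ℕ.+ k))) c y) ⟨
      ∣ fromℕ (odd (n ℕ.+ k)) * c * y ∣          ≡⟨ cong (λ t → ∣ t * y ∣) (coeff-step n k) ⟨
      ∣ coeff n k * y ∣                          ∎
      where
      i = + 1 / (2 ℕ.* suc k)
      c = coeff (suc n) k
      y = x ^ k
      w = c * y
      ∣i∣≤1 : ∣ i ∣ ≤ 1ℚ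
      ∣i∣≤1 = ≤-by (trans (0≤p⇒∣p∣≡p (0≤1/ℕ (2 ℕ.* suc k))) (sym (*-identityʳ i)))
        (sym (1/n*n≡1 (2 ℕ.* suc k)))
        (*-monoˡ-≤-nonNeg i {{normalize-nonNeg 1 (2 ℕ.* suc k)}} (fromℕ-mono {1} {2 ℕ.* suc k} (ℕ.s≤s ℕ.z≤n)))
      3A≤odd : 3 ℕ.* A ℕ.≤ odd (n ℕ.+ k)
      3A≤odd = ℕ.≤-trans (ℕ.*-monoˡ-≤ A {3} {6} (ℕ.m≤m+n 3 3))
        (ℕ.≤-trans 6A≤odd (ℕ.s≤s (ℕ.*-monoʳ-≤ 2 (ℕ.m≤m+n n k))))

    sums-close : ∀ m → ∣ sums (term n) (suc m) - coeff n 0 ∣ ≤ ½ * coeff n 0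
    sums-close m = subst₂ (λ s t → ∣ sums (term n) (suc m) - s ∣ ≤ ½ * t)
      (*-identityʳ (coeff n 0))
      (trans (cong ∣_∣ (*-identityʳ (coeff n 0))) (0≤p⇒∣p∣≡p (coeff-nonNeg n 0)))
      (geometric-close (term n) ratio m)

  module LowerBound (A : ℕ) (∣x∣≤A : ∣ x ∣ ≤ fromℕ A) (n : ℕ) (6A≤odd : 6 ℕ.* A ℕ.≤ odd n)
    (v z : ℚ) (1≤∣v∣ : 1ℚ ≤ ∣ v ∣) (∣z∣≤ : ∣ z ∣ ≤ fromℕ A * ∣ v ∣) where
    open ≤-Reasoning

    private
      e e′ : ℚ
      e  = coeff n 0
      e′ = coeff (suc n) 0

    6Ae′≤e : fromℕ 6 * fromℕ A * e′ ≤ e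
    6Ae′≤e = begin
      fromℕ 6 * fromℕ A * e′             ≡⟨ cong (_* e′) (fromℕ-* 6 A) ⟨
      fromℕ (6 ℕ.* A) * e′
        ≤⟨ *-monoʳ-≤-nonNeg e′ {{nonNegative (coeff-nonNeg (suc n) 0)}} (fromℕ-mono 6A≤odd) ⟩
      fromℕ (odd n) * e′                 ≡⟨ cong (λ m → fromℕ (odd m) * e′) (ℕ.+-identityʳ n) ⟨
      fromℕ (odd (n ℕ.+ 0)) * e′         ≡⟨ coeff-step n 0 ⟨
      e                                  ∎

    -- Replacing the first partial sum by `e` costs at most `∣v∣ e / 2`. The second is at most
    -- `(3/2) e′` in size, so its term contributes at most `(3/2) A e′ ∣v∣`, which `6Ae′≤e` turns
    -- into `∣v∣ e / 4`; hence the constant 6. What remains is `∣v∣ e / 4 ≥ e / 4`, uniformly in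
    -- `m`.
    lower-bound : ∀ m → ½ * (½ * e) ≤
      ∣ v * sums (term n) (suc m) + z * sums (term (suc n)) (suc m) ∣
    lower-bound m = begin
      ½ * (½ * e)                                          ≡⟨ *-identityˡ (½ * (½ * e)) ⟨
      1ℚ * (½ * (½ * e))
        ≤⟨ *-monoʳ-≤-nonNeg (½ * (½ * e)) {{nonNegative 0≤¼e}} 1≤∣v∣ ⟩
      ∣ v ∣ * (½ * (½ * e))
        ≡⟨ solve 2 (λ v e → v :* (con ½ :* (con ½ :* e)) := v :* e :- (v :* (con ½ :* e) :+ v :* (con ½ :* (con ½ :* e)))) refl ∣ v ∣ e ⟩
      ∣ v ∣ * e - (∣ v ∣ * (½ * e) + ∣ v ∣ * (½ * (½ * e)))
        ≤⟨ +-monoˡ-≤ (- (∣ v ∣ * (½ * e) + ∣ v ∣ * (½ * (½ * e)))) ∣v∣e≤ ⟩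
      ∣ l ∣ + (∣ v ∣ * (½ * e) + ∣ v ∣ * (½ * (½ * e))) - (∣ v ∣ * (½ * e) + ∣ v ∣ * (½ * (½ * e)))
                                                           ≡⟨ solve 2 (λ l r → l :+ r :- r := l) refl ∣ l ∣ (∣ v ∣ * (½ * e) + ∣ v ∣ * (½ * (½ * e))) ⟩
      ∣ l ∣                                                ∎
      where
      f = sums (term n) (suc m)
      f′ = sums (term (suc n)) (suc m)
      l = v * f + z * f′
      0≤¼e : 0ℚ ≤ ½ * (½ * e)
      0≤¼e = <⇒≤ (¼-pos (coeff-pos n))
      ∣f-e∣≤ : ∣ f - e ∣ ≤ ½ * e
      ∣f-e∣≤ = LeadingTerm.sums-close A ∣x∣≤A 6A≤odd m
      6A≤odd′ : 6 ℕ.* A ℕ.≤ odd (suc n)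
      6A≤odd′ = ℕ.≤-trans 6A≤odd (ℕ.s≤s (ℕ.*-monoʳ-≤ 2 (ℕ.n≤1+n n)))
      ∣f′∣≤ : ∣ f′ ∣ ≤ ½ * e′ + e′
      ∣f′∣≤ = subst (λ t → ∣ t ∣ ≤ ½ * e′ + e′) (solve 2 (λ f e → f :- e :+ e := f) refl f′ e′)
        (∣+∣-bound {f′ - e′} (LeadingTerm.sums-close A ∣x∣≤A 6A≤odd′ m)
          (≤-reflexive (0≤p⇒∣p∣≡p (coeff-nonNeg (suc n) 0))))
      ∣zf′∣≤ : ∣ z * f′ ∣ ≤ ∣ v ∣ * (½ * (½ * e))
      ∣zf′∣≤ = begin
        ∣ z * f′ ∣                               ≤⟨ ∣*∣-bound {z} ∣z∣≤ ∣f′∣≤ ⟩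
        fromℕ A * ∣ v ∣ * (½ * e′ + e′)
          ≡⟨ solve 3 (λ a v e → a :* v :* (con ½ :* e :+ e) := v :* (con ½ :* (con ½ :* (con (fromℕ 6) :* a :* e)))) refl
              (fromℕ A) ∣ v ∣ e′ ⟩
        ∣ v ∣ * (½ * (½ * (fromℕ 6 * fromℕ A * e′)))
          ≤⟨ *-monoˡ-≤-nonNeg ∣ v ∣ {{∣-∣-nonNeg v}} (*-monoˡ-≤-nonNeg ½ (*-monoˡ-≤-nonNeg ½ 6Ae′≤e)) ⟩
        ∣ v ∣ * (½ * (½ * e))                    ∎
      ∣v∣e≤ : ∣ v ∣ * e ≤ ∣ l ∣ + (∣ v ∣ * (½ * e) + ∣ v ∣ * (½ * (½ * e)))
      ∣v∣e≤ = begin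
        ∣ v ∣ * e                                ≡⟨ cong (∣ v ∣ *_) (0≤p⇒∣p∣≡p (coeff-nonNeg n 0)) ⟨
        ∣ v ∣ * ∣ e ∣                            ≡⟨ ∣p*q∣≡∣p∣*∣q∣ v e ⟨
        ∣ v * e ∣
          ≡⟨ cong ∣_∣ (solve 5 (λ v e f z g → v :* e := (v :* f :+ z :* g) :+ ((:- (v :* (f :- e))) :+ (:- (z :* g)))) refl v e f z f′) ⟩
        ∣ l + (- (v * (f - e)) + - (z * f′)) ∣   ≤⟨ ∣+∣-bound {l} ≤-refl (∣+∣-bound { - (v * (f - e))}
                                                      (∣-∣-bound {v * (f - e)} (∣*∣-bound {v} ≤-refl ∣f-e∣≤))
                                                      (∣-∣-bound {z * f′} ∣zf′∣≤)) ⟩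
        ∣ l ∣ + (∣ v ∣ * (½ * e) + ∣ v ∣ * (½ * (½ * e))) ∎

-- Limits of rational sequences: equality and apartness

Eventually : (ℕ → Set) → Set
Eventually P = ∃[ N ] ∀ {n} → N ℕ.≤ n → P n

ev-map : ∀ {P Q : ℕ → Set} → (∀ n → P n → Q n) → Eventually P → Eventually Q
ev-map f (N , p) = N , λ {n} N≤n → f n (p N≤n)

ev-zip : ∀ {P Q R : ℕ → Set} → (∀ n → P n → Q n → R n) →
  Eventually P → Eventually Q → Eventually R
ev-zip f (M , p) (N , q) = M ℕ.⊔ N , λ {n} ≤n →
  f n (p (ℕ.m⊔n≤o⇒m≤o M N ≤n)) (q (ℕ.m⊔n≤o⇒n≤o M N ≤n))

ev-suc : ∀ {P : ℕ → Set} → Eventually (λ n → P (suc n)) → Eventually P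
ev-suc (N , p) = suc N , λ { {suc n} (ℕ.s≤s N≤n) → p N≤n }

-- Cauchy proofs are left out, so that algebraic identities can be settled termwise by the ring
-- solver.
Seq : Set
Seq = ℕ → ℚ

private variable
  u v w u′ v′ : Seq

-- Equality of limits: for Cauchy sequences this is _≈ᴿ_.
infix 4 _∼_
record _∼_ (u v : Seq) : Set where
  constructor mk∼
  field
    close : ∀ {δ} → 0ℚ < δ → Eventually λ n → ∣ u n - v n ∣ ≤ δ
open _∼_

const : ℚ → Seq
const c _ = c

infixl 6 _⊕_
infixl 7 _⊛_
infix 8 ⊝_
_⊕_ _⊛_ : Seq → Seq → Seq
(u ⊕ v) n = u n + v n
(u ⊛ v) n = u n * v n
⊝_ : Seq → Seq
(⊝ u) n = - u n

Bounded : Seq → Set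
Bounded u = ∃[ B ] Eventually λ n → ∣ u n ∣ ≤ fromℕ B

≈ᴿ⇒∼ : ∀ x y → x ≈ᴿ y → seq x ∼ seq y
≈ᴿ⇒∼ x y x≈y = mk∼ λ {δ} 0<δ → ev-map (λ n → subst (_ ≤_) (+-identityˡ δ)) (x≈y 0<δ)

≡⇒∼ : (∀ n → u n ≡ v n) → u ∼ v
≡⇒∼ {u} {v} u≡v = mk∼ λ {δ} 0<δ → 0 , λ {n} _ →
  subst (λ t → ∣ t ∣ ≤ δ)
    (sym (trans (cong (_- v n) (u≡v n)) (+-inverseʳ (v n)))) (<⇒≤ 0<δ)

∼-refl : u ∼ u
∼-refl = ≡⇒∼ (λ _ → refl)

∼-sym : u ∼ v → v ∼ u
∼-sym {u} {v} u∼v = mk∼ λ {δ} 0<δ →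
  ev-map (λ n → subst (_≤ δ) (∣-∣-swap (u n) (v n))) (close u∼v 0<δ)

∼-trans : u ∼ v → v ∼ w → u ∼ w
∼-trans {u} {v} {w} u∼v v∼w = mk∼ λ {δ} 0<δ →
  ev-zip (λ n p q → subst (∣ u n - w n ∣ ≤_) (½+½ δ) (∣-∣-triangle (u n) (v n) (w n) p q))
    (close u∼v (½-pos 0<δ)) (close v∼w (½-pos 0<δ))

∼-setoid : Setoid _ _
∼-setoid = record
  { Carrier = Seq ; _≈_ = _∼_
  ; isEquivalence = record { refl = ∼-refl ; sym = ∼-sym ; trans = ∼-trans } }

⊕-cong : u ∼ u′ → v ∼ v′ → u ⊕ v ∼ u′ ⊕ v′
⊕-cong {u} {u′} {v} {v′} p q = mk∼ λ {δ} 0<δ →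
  ev-zip (λ n s t → subst₂ (λ s t → ∣ s ∣ ≤ t)
      (solve 4 (λ a a′ b b′ → (a :- a′) :+ (b :- b′) := (a :+ b) :- (a′ :+ b′)) refl
        (u n) (u′ n) (v n) (v′ n))
      (½+½ δ) (∣+∣-bound {u n - u′ n} s t))
    (close p (½-pos 0<δ)) (close q (½-pos 0<δ))

⊝-cong : u ∼ v → ⊝ u ∼ ⊝ v
⊝-cong {u} {v} p = mk∼ λ {δ} 0<δ →
  ev-map (λ n t → subst (λ s → ∣ s ∣ ≤ δ)
      (solve 2 (λ a b → :- (a :- b) := (:- a) :- (:- b)) refl (u n) (v n))
      (∣-∣-bound {u n - v n} t))
    (close p 0<δ)

-- The fixed factor must be bounded for a small difference to stay small. Later chains use
-- commutativity to bring the factor being rewritten to the right.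
⊛-congˡ : Bounded w → u ∼ v → w ⊛ u ∼ w ⊛ v
⊛-congˡ {w} {u} {v} (B , bound) p = mk∼ λ {δ} 0<δ →
  let (η , 0<η , small) = shrink B 0<δ
  in ev-zip (λ n s t → ≤-trans
         (subst (λ s → ∣ s ∣ ≤ fromℕ B * η)
           (solve 3 (λ a b c → c :* (a :- b) := c :* a :- c :* b) refl (u n) (v n) (w n))
           (∣*∣-bound {w n} s t))
         small)
       bound (close p 0<η)

-- A nonzero limit with an explicit witness and no choice of sign; the witness is what `_#0` will
-- need.
Apart : Seq → Set
Apart u = Σ[ ε ∈ ℚ ] 0ℚ < ε × Eventually λ n → ε ≤ ∣ u n ∣

-- From `u` to `c * v` at most half of `ε` is lost, so `∣ c * v ∣ ≥ ½ * ε`. Using `suc B` instead of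
-- `B` makes the factor to be cancelled positive.
factor-bound : ∀ B {c u v ε η} → ∣ c ∣ ≤ fromℕ B → fromℕ (suc B) * η ≤ ½ * ε →
  ε ≤ ∣ u ∣ → ∣ u - c * v ∣ ≤ ½ * ε → η ≤ ∣ v ∣
factor-bound B {c} {u} {v} {ε} {η} c≤B small ε≤u u≈cv =
  *-cancelˡ-≤-pos (fromℕ (suc B)) {{normalize-pos (suc B) 1}} (begin
    fromℕ (suc B) * η                           ≤⟨ small ⟩
    ½ * ε
      ≡⟨ solve 1 (λ e → con ½ :* e := e :- con ½ :* e) refl ε ⟩
    ε - ½ * ε                                   ≤⟨ +-monoˡ-≤ (- (½ * ε)) ε≤u ⟩
    ∣ u ∣ - ½ * ε
      ≡⟨ cong (λ t → ∣ t ∣ - ½ * ε) (solve 2 (λ u w → u := (u :- w) :+ w) refl u (c * v)) ⟩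
    ∣ (u - c * v) + c * v ∣ - ½ * ε             ≤⟨ +-monoˡ-≤ (- (½ * ε)) (∣+∣-bound {u - c * v} u≈cv
                                                     (∣*∣-bound {c} {b = v} (≤-trans c≤B (fromℕ-mono (ℕ.n≤1+n B))) ≤-refl)) ⟩
    ½ * ε + fromℕ (suc B) * ∣ v ∣ - ½ * ε
      ≡⟨ solve 2 (λ h r → h :+ r :- h := r) refl (½ * ε) (fromℕ (suc B) * ∣ v ∣) ⟩
    fromℕ (suc B) * ∣ v ∣                       ∎)
  where open ≤-Reasoning

-- Carries apartness back from the outcome of a recurrence step to the form it started from, with
-- `c` the denominator `b`.
apart-factor : ∀ c → u ∼ const c ⊛ v → Apart u → Apart v
apart-factor {u} {v} c u∼cv (ε , 0<ε , ε≤u) =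
  let (B , c≤B)         = ≤fromℕ ∣ c ∣
      (η , 0<η , small) = shrink (suc B) (½-pos 0<ε)
  in η , 0<η , ev-zip (λ n → factor-bound B {c} {u n} {v n} c≤B small)
       ε≤u (close u∼cv (½-pos 0<ε))

apart⇒≁0 : Apart u → ¬ (u ∼ const 0ℚ)
apart⇒≁0 {u} (ε , 0<ε , ε≤u) u∼0 =
  -- At a common index the two bounds give `ε ≤ ½ * ε`.
  let (N , both) = ev-zip {R = λ _ → ε ≤ ½ * ε}
        (λ n p q → ≤-trans p (subst (λ t → ∣ t ∣ ≤ ½ * ε) (+-identityʳ (u n)) q))
        ε≤u (close u∼0 (½-pos 0<ε))
  in <-irrefl refl (<-≤-trans (+-mono-<-≤ (½-pos 0<ε) ≤-refl)
       (≤-by (½+½ ε) (+-identityˡ (½ * ε)) (both {N} ℕ.≤-refl)))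

-- Integer linear forms in `F n` and `F (suc n)`: descent

module LinearForms (x : ℚ) (x≢0 : x ≢ 0ℚ) where
  open Series x

  private
    a : ℤ
    a = ↥ x
    b A : ℕ
    b = ↧ₙ x
    A = ℤ.∣ a ∣

  form : ℤ → ℤ → ℕ → Seq
  form v z n m = fromℤ v * seq (F n) m + fromℤ z * seq (F (suc n)) m

  step-v : ℤ → ℤ → ℕ → ℤ
  step-v v z n = + b ℤ.* (+ odd n ℤ.* v ℤ.+ z)

  -- The recurrence F n = (2n+1) F (n+1) + x F (n+2), cleared of the denominator b of x.
  form-step : ∀ v z n → form (step-v v z n) (a ℤ.* v) (suc n) ∼ const (fromℕ b) ⊛ form v z n
  form-step v z n = mk∼ λ {δ} 0<δ →
    let (B , w≤B)         = ≤fromℕ ∣ fromℤ (a ℤ.* v) ∣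
        (η , 0<η , small) = shrink B 0<δ
        (N , F-close)     = cauchy (F (2 ℕ.+ n)) 0<η
    in ev-suc (N , λ {m} N≤m → ≤-trans
         (subst (λ t → ∣ t ∣ ≤ fromℕ B * η) (sym (difference m))
           (∣*∣-bound {fromℤ (a ℤ.* v)} w≤B (F-close (ℕ.m≤n⇒m≤1+n N≤m) N≤m)))
         small)
    where
    open ≡-Reasoning
    -- The missing last term in `sums-rec` leaves an increment of `F (2 ℕ.+ n)`, which vanishes only
    -- in the limit; hence `∼` and not termwise equality.
    difference : ∀ m → form (step-v v z n) (a ℤ.* v) (suc n) (suc m) - fromℕ b * form v z n (suc m)
      ≡ fromℤ (a ℤ.* v) * (seq (F (2 ℕ.+ n)) (suc m) - seq (F (2 ℕ.+ n)) m)
    difference m = begin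
      fromℤ (step-v v z n) * g + p * h′ - fromℕ b * (fromℤ v * seq (F n) (suc m) + fromℤ z * g)
        ≡⟨ cong₂ (λ s t → s * g + p * h′ - fromℕ b * (fromℤ v * t + fromℤ z * g)) step-v-ℚ (sums-rec n m) ⟩
      fromℕ b * (fromℕ (odd n) * fromℤ v + fromℤ z) * g + p * h′ - fromℕ b * (fromℤ v * (fromℕ (odd n) * g + x * h) + fromℤ z * g)
        ≡⟨ solve 9 (λ b o v z g p h h′ x → b :* (o :* v :+ z) :* g :+ p :* h′ :- b :* (v :* (o :* g :+ x :* h) :+ z :* g)
                 := p :* h′ :- x :* b :* v :* h) refl (fromℕ b) (fromℕ (odd n)) (fromℤ v) (fromℤ z) g p h h′ x ⟩
      p * h′ - x * fromℕ b * fromℤ v * h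
        ≡⟨ cong (λ t → p * h′ - t * h) (trans (cong (_* fromℤ v) (*-↧≡↥ x)) (sym (fromℤ-* a v))) ⟩
      p * h′ - p * h
        ≡⟨ solve 3 (λ p s t → p :* s :- p :* t := p :* (s :- t)) refl p h′ h ⟩
      p * (h′ - h) ∎
      where
      p = fromℤ (a ℤ.* v)
      g = seq (F (suc n)) (suc m)
      h = seq (F (2 ℕ.+ n)) m
      h′ = seq (F (2 ℕ.+ n)) (suc m)
      step-v-ℚ : fromℤ (step-v v z n) ≡ fromℕ b * (fromℕ (odd n) * fromℤ v + fromℤ z)
      step-v-ℚ = trans (fromℤ-* (+ b) (+ odd n ℤ.* v ℤ.+ z)) (cong (fromℕ b *_)
        (trans (fromℤ-+ (+ odd n ℤ.* v) z) (cong (_+ fromℤ z) (fromℤ-* (+ odd n) v))))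

  -- The denominator `b` is at least 1.
  ∣x∣≤A : ∣ x ∣ ≤ fromℕ A
  ∣x∣≤A = ≤-by (sym (*-identityʳ ∣ x ∣))
    (trans (sym (∣fromℤ∣ a)) (trans (cong ∣_∣ (sym (*-↧≡↥ x)))
      (trans (∣p*q∣≡∣p∣*∣q∣ x (fromℕ b)) (cong (∣ x ∣ *_) (0≤p⇒∣p∣≡p (fromℕ-nonNeg b))))))
    (*-monoˡ-≤-nonNeg ∣ x ∣ {{∣-∣-nonNeg x}} (fromℕ-mono {1} {b} (ℕ.s≤s ℕ.z≤n)))

  NonTrivial : ℤ → ℤ → Set
  NonTrivial v z = ¬ (v ≡ + 0 × z ≡ + 0)

  -- The step is a linear map of determinant `- (a b)`, nonzero because `x ≢ 0ℚ`.
  step-nonTrivial : ∀ v z n → NonTrivial v z → NonTrivial (step-v v z n) (a ℤ.* v)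
  step-nonTrivial v z n nt (v⁺≡0 , av≡0) with ℤ.i*j≡0⇒i≡0∨j≡0 a av≡0
  ... | inj₁ a≡0 = x≢0 (↥p≡0⇒p≡0 x a≡0)
  ... | inj₂ refl with ℤ.i*j≡0⇒i≡0∨j≡0 (+ b) v⁺≡0
  ...   | inj₂ w≡0 = nt (refl , trans (sym (ℤ.+-identityˡ z))
                       (trans (cong (ℤ._+ z) (sym (ℤ.*-zeroʳ (+ odd n)))) w≡0))

  dominant-apart : ∀ v z n → 6 ℕ.* A ℕ.≤ odd n → 1 ℕ.≤ ℤ.∣ v ∣ → ℤ.∣ z ∣ ℕ.≤ A ℕ.* ℤ.∣ v ∣ →
    Apart (form v z n)
  dominant-apart v z n 6A≤odd 1≤v z≤v = ½ * (½ * coeff n 0) , ¼-pos (coeff-pos n) ,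
    -- `lower-bound` concerns partial sums with at least one term, hence the shift.
    ev-suc (0 , λ {m} _ → LowerBound.lower-bound A ∣x∣≤A n 6A≤odd (fromℤ v) (fromℤ z)
      (≤-by refl (∣fromℤ∣ v) (fromℕ-mono 1≤v))
      (≤-by (∣fromℤ∣ z) (trans (cong (fromℕ A *_) (∣fromℤ∣ v)) (sym (fromℕ-* A ℤ.∣ v ∣))) (fromℕ-mono z≤v))
      m)

  -- As long as the form is not dominated by its first term, |v| strictly decreases.
  descent : ∀ fuel v z n → 6 ℕ.* A ℕ.≤ odd n → NonTrivial v z → ℤ.∣ v ∣ ℕ.≤ fuel → Apart (form v z n)
  descent fuel v z n 6A≤odd nt ≤fuel =
    -- Comparing `∣v∣` with `∣v⁺∣` is decidable, so the descent is constructive and returns an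
    -- explicit lower bound.
    apart-factor (fromℕ b) (form-step v z n) (next fuel ≤fuel (ℤ.∣ v ∣ ℕ.≤? ℤ.∣ v⁺ ∣))
    where
    v⁺ z⁺ : ℤ
    v⁺ = step-v v z n
    z⁺ = a ℤ.* v
    nt⁺ = step-nonTrivial v z n nt
    6A≤odd⁺ : 6 ℕ.* A ℕ.≤ odd (suc n)
    6A≤odd⁺ = ℕ.≤-trans 6A≤odd (ℕ.s≤s (ℕ.*-monoʳ-≤ 2 (ℕ.n≤1+n n)))
    -- If `v⁺` vanished, so would `v`, and with it `z⁺ = a v`, against nontriviality of the new
    -- form.
    v⁺≢0 : ℤ.∣ v ∣ ℕ.≤ ℤ.∣ v⁺ ∣ → ℤ.∣ v⁺ ∣ ≢ 0
    v⁺≢0 v≤v⁺ ∣v⁺∣≡0 = nt⁺ (ℤ.∣i∣≡0⇒i≡0 ∣v⁺∣≡0 ,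
      trans (cong (a ℤ.*_) (ℤ.∣i∣≡0⇒i≡0 (ℕ.n≤0⇒n≡0 (ℕ.≤-trans v≤v⁺ (ℕ.≤-reflexive ∣v⁺∣≡0))))) (ℤ.*-zeroʳ a))
    next : ∀ fuel → ℤ.∣ v ∣ ℕ.≤ fuel → Dec (ℤ.∣ v ∣ ℕ.≤ ℤ.∣ v⁺ ∣) → Apart (form v⁺ z⁺ (suc n))
    -- Here `∣z⁺∣ = A ∣v∣ ≤ A ∣v⁺∣`, which is the dominance condition for the new form.
    next _ _ (yes v≤v⁺) = dominant-apart v⁺ z⁺ (suc n) 6A≤odd⁺ (ℕ.n≢0⇒n>0 (v⁺≢0 v≤v⁺))
      (ℕ.≤-trans (ℕ.≤-reflexive (ℤ.∣i*j∣≡∣i∣*∣j∣ a v)) (ℕ.*-monoʳ-≤ A v≤v⁺))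
    -- No fuel means `∣v∣ = 0`, and zero cannot decrease.
    next zero ≤0 (no v≰v⁺) = contradiction (ℕ.≤-trans ≤0 ℕ.z≤n) v≰v⁺
    next (suc fuel) ≤fuel (no v≰v⁺) = descent fuel v⁺ z⁺ (suc n) 6A≤odd⁺ nt⁺
      (ℕ.≤-pred (ℕ.≤-trans (ℕ.≰⇒> v≰v⁺) ≤fuel))

  -- Takes `j` recurrence steps to reach an index large enough for `descent`.
  form-apart : ∀ j v z n → 6 ℕ.* A ℕ.≤ odd (j ℕ.+ n) → NonTrivial v z → Apart (form v z n)
  form-apart zero    v z n 6A≤ nt = descent ℤ.∣ v ∣ v z n 6A≤ nt ℕ.≤-refl
  form-apart (suc j) v z n 6A≤ nt = apart-factor (fromℕ b) (form-step v z n)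
    (form-apart j (step-v v z n) (a ℤ.* v) (suc n)
      (subst (λ m → 6 ℕ.* A ℕ.≤ odd m) (sym (ℕ.+-suc j n)) 6A≤)
      (step-nonTrivial v z n nt))

  independent : ∀ v z → NonTrivial v z → Apart (form v z 0)
  -- `3A` steps suffice, as `odd (3A) = 6A + 1`.
  independent v z = form-apart (3 ℕ.* A) v z 0 (begin
    6 ℕ.* A                     ≡⟨ ℕ.*-assoc 2 3 A ⟩
    2 ℕ.* (3 ℕ.* A)             ≡⟨ cong (2 ℕ.*_) (ℕ.+-identityʳ (3 ℕ.* A)) ⟨
    2 ℕ.* (3 ℕ.* A ℕ.+ 0)       ≤⟨ ℕ.n≤1+n (2 ℕ.* (3 ℕ.* A ℕ.+ 0)) ⟩
    odd (3 ℕ.* A ℕ.+ 0)         ∎)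
    where open ℕ.≤-Reasoning

-- Complex sequences and sums with a common factor

bounded-const : ∀ c → Bounded (const c)
bounded-const c = bounded (constᴿ c)

-- Go from the limit to `X n` for one fixed large `n`, then to `w` times the constant `seq T n`,
-- then to `w ⊛ seq T`. The first passage costs two quarters of `δ`, the others one each.
lim-∼ : ∀ X (cX : IsCauchyᴿ X) T → Bounded w → (∀ n → seq (X n) ∼ w ⊛ const (seq T n)) →
  seq (lim X cX) ∼ w ⊛ seq T
lim-∼ {w} X cX T (B , w≤B) X∼ = mk∼ λ {δ} 0<δ →
  let (η , 0<η , small) = shrink B (¼-pos 0<δ)
      (N₁ , X⟶)         = lim-converges X cX (¼-pos 0<δ)
      (N₂ , T-close)    = cauchy T 0<η
      n                 = N₁ ℕ.⊔ N₂
      N₂≤n              = ℕ.m≤n⊔m N₁ N₂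
      tail : Eventually λ m → ∣ w m * seq T n - w m * seq T m ∣ ≤ ½ * (½ * δ)
      tail = ev-zip (λ m p q → ≤-trans
          (subst (λ t → ∣ t ∣ ≤ fromℕ B * η)
            (solve 3 (λ w a b → w :* (a :- b) := w :* a :- w :* b) refl (w m) (seq T n) (seq T m))
            (∣*∣-bound {w m} p q))
          small)
        w≤B (N₂ , λ N₂≤m → T-close N₂≤n N₂≤m)
  in ev-zip (λ m p q → subst (∣ seq (lim X cX) m - w m * seq T m ∣ ≤_) (¼+¼+¼+¼ δ)
         (∣-∣-triangle (seq (lim X cX) m) (seq (X n) m) (w m * seq T m)
           (subst (_≤ ½ * (½ * δ) + ½ * (½ * δ)) (∣-∣-swap (seq (X n) m) (seq (lim X cX) m)) p) q))
       (X⟶ (ℕ.m≤m⊔n N₁ N₂) (¼-pos 0<δ))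
       (ev-zip (λ m p q → ∣-∣-triangle (seq (X n) m) (w m * seq T n) (w m * seq T m) p q)
         (_∼_.close (X∼ n) (¼-pos 0<δ)) tail)

Seqᶜ : Set
Seqᶜ = Seq × Seq

infixl 7 _⊗_
-- Written exactly as `_*ᶜ_` unfolds, so that `⟪ z *ᶜ w ⟫` is `⟪ z ⟫ ⊗ ⟪ w ⟫` by definition.
_⊗_ : Seqᶜ → Seqᶜ → Seqᶜ
(a , b) ⊗ (c , d) = a ⊛ c ⊕ ⊝ (b ⊛ d) , a ⊛ d ⊕ b ⊛ c

real : Seq → Seqᶜ
real u = u , const 0ℚ

⟪_⟫ : ℂ → Seqᶜ
⟪ z ⟫ = seq (re z) , seq (im z)

infix 4 _∼ᶜ_
record _∼ᶜ_ (z w : Seqᶜ) : Set where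
  constructor _,_
  field
    re-∼ : proj₁ z ∼ proj₁ w
    im-∼ : proj₂ z ∼ proj₂ w
open _∼ᶜ_

Boundedᶜ : Seqᶜ → Set
Boundedᶜ (a , b) = Bounded a × Bounded b

boundedᶜ : ∀ z → Boundedᶜ ⟪ z ⟫
boundedᶜ z = bounded (re z) , bounded (im z)

∼ᶜ-setoid : Setoid _ _
∼ᶜ-setoid = record
  { Carrier = Seqᶜ ; _≈_ = _∼ᶜ_
  ; isEquivalence = record
    { refl  = ∼-refl , ∼-refl
    ; sym   = λ (p , q) → ∼-sym p , ∼-sym q
    ; trans = λ (p , q) (p′ , q′) → ∼-trans p p′ , ∼-trans q q′ } }

open Setoid ∼ᶜ-setoid using () renaming (refl to ∼ᶜ-refl; sym to ∼ᶜ-sym; trans to ∼ᶜ-trans)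

⊗-congˡ : ∀ {z x y} → Boundedᶜ z → x ∼ᶜ y → z ⊗ x ∼ᶜ z ⊗ y
⊗-congˡ (a , b) (p , q) =
    ⊕-cong (⊛-congˡ a p) (⊝-cong (⊛-congˡ b q))
  , ⊕-cong (⊛-congˡ a q) (⊛-congˡ b p)

⊗-comm : ∀ x y → x ⊗ y ∼ᶜ y ⊗ x
⊗-comm (a , b) (c , d) =
    ≡⇒∼ (λ n → solve 4 (λ a b c d → a :* c :+ :- (b :* d) := c :* a :+ :- (d :* b)) refl (a n) (b n) (c n) (d n))
  , ≡⇒∼ (λ n → solve 4 (λ a b c d → a :* d :+ b :* c := c :* b :+ d :* a) refl (a n) (b n) (c n) (d n))

⊗-assoc : ∀ x y z → (x ⊗ y) ⊗ z ∼ᶜ x ⊗ (y ⊗ z)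
⊗-assoc (a , b) (c , d) (e , f) =
    ≡⇒∼ (λ n → solve 6 (λ a b c d e f →
      (a :* c :+ :- (b :* d)) :* e :+ :- ((a :* d :+ b :* c) :* f) :=
      a :* (c :* e :+ :- (d :* f)) :+ :- (b :* (c :* f :+ d :* e))) refl (a n) (b n) (c n) (d n) (e n) (f n))
  , ≡⇒∼ (λ n → solve 6 (λ a b c d e f →
      (a :* c :+ :- (b :* d)) :* f :+ (a :* d :+ b :* c) :* e :=
      a :* (c :* f :+ d :* e) :+ b :* (c :* e :+ :- (d :* f))) refl (a n) (b n) (c n) (d n) (e n) (f n))

⊗-identityʳ : ∀ x → x ⊗ real (const 1ℚ) ∼ᶜ x
⊗-identityʳ (a , b) =
    ≡⇒∼ (λ n → solve 2 (λ a b → a :* con 1ℚ :+ :- (b :* con 0ℚ) := a) refl (a n) (b n))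
  , ≡⇒∼ (λ n → solve 2 (λ a b → a :* con 0ℚ :+ b :* con 1ℚ := b) refl (a n) (b n))

real-⊗ : ∀ u v → real u ⊗ real v ∼ᶜ real (u ⊛ v)
real-⊗ u v =
    ≡⇒∼ (λ n → solve 2 (λ u v → u :* v :+ :- (con 0ℚ :* con 0ℚ) := u :* v) refl (u n) (v n))
  , ≡⇒∼ (λ n → solve 2 (λ u v → u :* con 0ℚ :+ con 0ℚ :* v := con 0ℚ) refl (u n) (v n))

⊗-real : ∀ x y v → (x , y) ⊗ real v ∼ᶜ (x ⊛ v , y ⊛ v)
⊗-real x y v =
    ≡⇒∼ (λ n → solve 3 (λ x y v → x :* v :+ :- (y :* con 0ℚ) := x :* v) refl (x n) (y n) (v n))
  , ≡⇒∼ (λ n → solve 3 (λ x y v → x :* con 0ℚ :+ y :* v := y :* v) refl (x n) (y n) (v n))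

-- A series whose terms are rational up to a common complex factor `z`: 1 for cosine, `r` for sine.
-- Summation then reduces to the rational partial sums of `τ`.
module _ (t : ℕ → ℂ) (t-summable : Summable t) (z : Seqᶜ) (z-bounded : Boundedᶜ z) (τ : Seq)
  (t∼ : ∀ k → ⟪ t k ⟫ ∼ᶜ z ⊗ real (const (τ k))) where

  partialSum-∼ : ∀ n → ⟪ partialSum t n ⟫ ∼ᶜ (proj₁ z ⊛ const (sums τ n) , proj₂ z ⊛ const (sums τ n))
  partialSum-∼ zero    = ≡⇒∼ (λ n → sym (*-zeroʳ (proj₁ z n))) , ≡⇒∼ (λ n → sym (*-zeroʳ (proj₂ z n)))
  partialSum-∼ (suc k) =
    let (p , q)   = partialSum-∼ k
        (p′ , q′) = ∼ᶜ-trans (t∼ k) (⊗-real (proj₁ z) (proj₂ z) (const (τ k)))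
    in ∼-trans (⊕-cong p p′) (≡⇒∼ λ n → sym (*-distribˡ-+ (proj₁ z n) (sums τ k) (τ k)))
     , ∼-trans (⊕-cong q q′) (≡⇒∼ λ n → sym (*-distribˡ-+ (proj₂ z n) (sums τ k) (τ k)))

  infinite-sum-∼ : IsCauchy (sums τ) → ⟪ infinite-sum t t-summable ⟫ ∼ᶜ z ⊗ real (sums τ)
  infinite-sum-∼ cauchy = ∼ᶜ-trans
    ( lim-∼ (λ n → re (partialSum t n)) (Summable.re-cauchy t-summable) (mkℝ (sums τ) cauchy)
        (proj₁ z-bounded) (λ n → re-∼ (partialSum-∼ n))
    , lim-∼ (λ n → im (partialSum t n)) (Summable.im-cauchy t-summable) (mkℝ (sums τ) cauchy)
        (proj₂ z-bounded) (λ n → im-∼ (partialSum-∼ n)))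
    (∼ᶜ-sym (⊗-real (proj₁ z) (proj₂ z) (sums τ)))

-- Cosine and sine of `r` through `F 0` and `F 1`

/-≡-* : ∀ i n .{{_ : ℕ.NonZero n}} → i / n ≡ fromℤ i * (+ 1 / n)
/-≡-* i (suc n) = toℚᵘ-injective
  (ℚᵘ.≃-trans (toℚᵘ-fromℚᵘ (ℚᵘ.mkℚᵘ i n))
  (ℚᵘ.≃-trans (ℚᵘ.*≡* (trans (cong (i ℤ.*_) (cong (λ m → + suc m) (ℕ.+-identityʳ n)))
                             (cong (ℤ._* + suc n) (sym (ℤ.*-identityʳ i)))))
  (ℚᵘ.≃-sym (ℚᵘ.≃-trans (toℚᵘ-homo-* (fromℤ i) (+ 1 / suc n))
    (ℚᵘ.*-cong (toℚᵘ-fromℤ i) (toℚᵘ-fromℚᵘ (ℚᵘ.mkℚᵘ (+ 1) n)))))))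

-1^*^ : ∀ s k → fromℤ (-1ℤ ℤ.^ k) * s ^ k ≡ (- s) ^ k
-1^*^ s zero    = refl
-1^*^ s (suc k) = begin
  fromℤ (-1ℤ ℤ.* -1ℤ ℤ.^ k) * (s * s ^ k)        ≡⟨ cong (_* (s * s ^ k)) (fromℤ-* -1ℤ (-1ℤ ℤ.^ k)) ⟩
  fromℤ -1ℤ * fromℤ (-1ℤ ℤ.^ k) * (s * s ^ k)
    ≡⟨ solve 3 (λ e s t → con (fromℤ -1ℤ) :* e :* (s :* t) := :- s :* (e :* t)) refl (fromℤ (-1ℤ ℤ.^ k)) s (s ^ k) ⟩
  - s * (fromℤ (-1ℤ ℤ.^ k) * s ^ k)              ≡⟨ cong (- s *_) (-1^*^ s k) ⟩
  - s * (- s) ^ k                                ∎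
  where open ≡-Reasoning

-- The alternating sign is absorbed into the base of the power, which is why `F` is taken at `- s`.
-- The hypothesis on `c` forces `c = 1 / m`.
signed-coeff : ∀ s k m .{{_ : ℕ.NonZero m}} c → c * fromℕ m ≡ 1ℚ → (-1ℤ ℤ.^ k / m) * s ^ k ≡ c * (- s) ^ k
signed-coeff s k m c c*m≡1 = begin
  (-1ℤ ℤ.^ k / m) * s ^ k                        ≡⟨ cong (_* s ^ k) (/-≡-* (-1ℤ ℤ.^ k) m) ⟩
  fromℤ (-1ℤ ℤ.^ k) * i * s ^ k
    ≡⟨ solve 3 (λ e i t → e :* i :* t := i :* (e :* t)) refl (fromℤ (-1ℤ ℤ.^ k)) i (s ^ k) ⟩
  i * (fromℤ (-1ℤ ℤ.^ k) * s ^ k)                ≡⟨ cong₂ _*_ i≡c (-1^*^ s k) ⟩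
  c * (- s) ^ k                                  ∎
  where
  open ≡-Reasoning
  i = + 1 / m
  i≡c : i ≡ c
  i≡c = begin
    i                    ≡⟨ *-identityʳ i ⟨
    i * 1ℚ               ≡⟨ cong (i *_) c*m≡1 ⟨
    i * (c * fromℕ m)    ≡⟨ solve 3 (λ i c m → i :* (c :* m) := i :* m :* c) refl i c (fromℕ m) ⟩
    i * fromℕ m * c      ≡⟨ cong (_* c) (1/n*n≡1 m) ⟩
    1ℚ * c               ≡⟨ *-identityˡ c ⟩
    c                    ∎

module Trigonometric (r : ℂ) (s : ℚ) (r²≈s : r ^ᶜ 2 ≈ ι s) where
  open import Relation.Binary.Reasoning.Setoid ∼ᶜ-setoid
  open Series (- s) using (term; F)

  r²∼s : ⟪ r ⟫ ⊗ ⟪ r ⟫ ∼ᶜ real (const s)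
  r²∼s = begin
    -- `r ^ᶜ 2` unfolds to `r *ᶜ (r *ᶜ ι 1ℚ)`, so the trailing unit has to be restored first.
    ⟪ r ⟫ ⊗ ⟪ r ⟫                         ≈⟨ ⊗-congˡ (boundedᶜ r) (⊗-identityʳ ⟪ r ⟫) ⟨
    ⟪ r ⟫ ⊗ (⟪ r ⟫ ⊗ real (const 1ℚ))
      ≈⟨ ≈ᴿ⇒∼ (re (r ^ᶜ 2)) (constᴿ s) (proj₁ r²≈s) , ≈ᴿ⇒∼ (im (r ^ᶜ 2)) (constᴿ 0ℚ) (proj₂ r²≈s) ⟩
    real (const s)                        ∎

  r*r*-∼ : ∀ {u} → Bounded u → ⟪ r ⟫ ⊗ (⟪ r ⟫ ⊗ real u) ∼ᶜ real (const s ⊛ u)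
  r*r*-∼ {u} u-bounded = begin
    ⟪ r ⟫ ⊗ (⟪ r ⟫ ⊗ real u)      ≈⟨ ⊗-assoc ⟪ r ⟫ ⟪ r ⟫ (real u) ⟨
    (⟪ r ⟫ ⊗ ⟪ r ⟫) ⊗ real u      ≈⟨ ⊗-comm (⟪ r ⟫ ⊗ ⟪ r ⟫) (real u) ⟩
    real u ⊗ (⟪ r ⟫ ⊗ ⟪ r ⟫)      ≈⟨ ⊗-congˡ (u-bounded , bounded-const 0ℚ) r²∼s ⟩
    real u ⊗ real (const s)       ≈⟨ ⊗-comm (real u) (real (const s)) ⟩
    real (const s) ⊗ real u       ≈⟨ real-⊗ (const s) u ⟩
    real (const s ⊛ u)            ∎

  even-power : ∀ k → ⟪ r ^ᶜ (2 ℕ.* k) ⟫ ∼ᶜ real (const (s ^ k))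
  even-power zero    = ∼ᶜ-refl
  even-power (suc k) = begin
    ⟪ r ^ᶜ (2 ℕ.* suc k) ⟫                   ≡⟨ cong (λ m → ⟪ r ^ᶜ m ⟫) (ℕ.*-suc 2 k) ⟩
    ⟪ r ⟫ ⊗ (⟪ r ⟫ ⊗ ⟪ r ^ᶜ (2 ℕ.* k) ⟫)
      ≈⟨ ⊗-congˡ (boundedᶜ r) (⊗-congˡ (boundedᶜ r) (even-power k)) ⟩
    ⟪ r ⟫ ⊗ (⟪ r ⟫ ⊗ real (const (s ^ k)))   ≈⟨ r*r*-∼ (bounded-const (s ^ k)) ⟩
    real (const (s ^ suc k))                 ∎

  odd-power : ∀ k → ⟪ r ^ᶜ (2 ℕ.* k ℕ.+ 1) ⟫ ∼ᶜ ⟪ r ⟫ ⊗ real (const (s ^ k))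
  odd-power k = begin
    ⟪ r ^ᶜ (2 ℕ.* k ℕ.+ 1) ⟫        ≡⟨ cong (λ m → ⟪ r ^ᶜ m ⟫) (ℕ.+-comm (2 ℕ.* k) 1) ⟩
    ⟪ r ⟫ ⊗ ⟪ r ^ᶜ (2 ℕ.* k) ⟫      ≈⟨ ⊗-congˡ (boundedᶜ r) (even-power k) ⟩
    ⟪ r ⟫ ⊗ real (const (s ^ k))    ∎

  -- Brings the common factor `z` to the front and merges the rational factors, as `infinite-sum-∼`
  -- expects.
  power-term-∼ : ∀ k m c z → Boundedᶜ z → c * fromℕ (m !) ≡ 1ℚ → ⟪ r ^ᶜ m ⟫ ∼ᶜ z ⊗ real (const (s ^ k)) →
    ⟪ power-term k r m ⟫ ∼ᶜ z ⊗ real (const (c * (- s) ^ k))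
  power-term-∼ k m c z z-bounded c*m!≡1 r^m∼ = begin
    real (const e) ⊗ ⟪ r ^ᶜ m ⟫
      ≈⟨ ⊗-congˡ (bounded-const e , bounded-const 0ℚ) r^m∼ ⟩
    real (const e) ⊗ (z ⊗ real (const (s ^ k)))
      ≈⟨ ⊗-comm (real (const e)) (z ⊗ real (const (s ^ k))) ⟩
    (z ⊗ real (const (s ^ k))) ⊗ real (const e)
      ≈⟨ ⊗-assoc z (real (const (s ^ k))) (real (const e)) ⟩
    z ⊗ (real (const (s ^ k)) ⊗ real (const e))
      ≈⟨ ⊗-congˡ z-bounded (real-⊗ (const (s ^ k)) (const e)) ⟩
    z ⊗ real (const (s ^ k * e))
      ≡⟨ cong (λ t → z ⊗ real (const t)) (trans (*-comm (s ^ k) e) (signed-coeff s k (m !) {{m !≢0}} c c*m!≡1)) ⟩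
    z ⊗ real (const (c * (- s) ^ k))                     ∎
    where
    e = (-1ℤ ℤ.^ k / m !) {{m !≢0}}

  cos-∼ : ⟪ cos r ⟫ ∼ᶜ real (seq (F 0))
  cos-∼ = begin
    ⟪ cos r ⟫
      ≈⟨ infinite-sum-∼ (cos-term r) (cos-summable r) (real (const 1ℚ)) 1-bounded (term 0)
          (λ k → power-term-∼ k (2 ℕ.* k) (coeff 0 k) (real (const 1ℚ)) 1-bounded (coeff-cos k)
          (even-power′ k))
          (cauchy (F 0)) ⟩
    real (const 1ℚ) ⊗ real (seq (F 0))     ≈⟨ ⊗-comm (real (const 1ℚ)) (real (seq (F 0))) ⟩
    real (seq (F 0)) ⊗ real (const 1ℚ)     ≈⟨ ⊗-identityʳ (real (seq (F 0))) ⟩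
    real (seq (F 0))                       ∎
    where
    1-bounded : Boundedᶜ (real (const 1ℚ))
    1-bounded = bounded-const 1ℚ , bounded-const 0ℚ
    even-power′ : ∀ k → ⟪ r ^ᶜ (2 ℕ.* k) ⟫ ∼ᶜ real (const 1ℚ) ⊗ real (const (s ^ k))
    even-power′ k = begin
      ⟪ r ^ᶜ (2 ℕ.* k) ⟫                       ≈⟨ even-power k ⟩
      real (const (s ^ k))                     ≈⟨ ⊗-identityʳ (real (const (s ^ k))) ⟨
      real (const (s ^ k)) ⊗ real (const 1ℚ)   ≈⟨ ⊗-comm (real (const (s ^ k))) (real (const 1ℚ)) ⟩
      real (const 1ℚ) ⊗ real (const (s ^ k))   ∎

  sin-∼ : ⟪ sin r ⟫ ∼ᶜ ⟪ r ⟫ ⊗ real (seq (F 1))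
  sin-∼ = infinite-sum-∼ (sin-term r) (sin-summable r) ⟪ r ⟫ (boundedᶜ r) (term 1)
    (λ k → power-term-∼ k (2 ℕ.* k ℕ.+ 1) (coeff 1 k) ⟪ r ⟫ (boundedᶜ r)
      (subst (λ m → coeff 1 k * fromℕ (m !) ≡ 1ℚ) (ℕ.+-comm 1 (2 ℕ.* k)) (coeff-sin k)) (odd-power k))
    (cauchy (F 1))

  -- Multiplying by `cos r` removes the reciprocal: `ρ cos r = r sin r = r² F 1 = s F 1`. The real
  -- part is the claim.
  r*tan-∼ : ∀ c ρ → r *ᶜ tan r c ≈ ι ρ → const ρ ⊛ seq (F 0) ∼ const s ⊛ seq (F 1)
  r*tan-∼ c ρ (re≈ , im≈) = re-∼ (begin
    real (const ρ ⊛ seq (F 0))                        ≈⟨ real-⊗ (const ρ) (seq (F 0)) ⟨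
    real (const ρ) ⊗ real (seq (F 0))
      ≈⟨ ⊗-congˡ (bounded-const ρ , bounded-const 0ℚ) cos-∼ ⟨
    real (const ρ) ⊗ ⟪ cos r ⟫                        ≈⟨ ⊗-comm (real (const ρ)) ⟪ cos r ⟫ ⟩
    ⟪ cos r ⟫ ⊗ real (const ρ)                        ≈⟨ ⊗-congˡ (boundedᶜ (cos r)) r*tan∼ρ ⟨
    ⟪ cos r ⟫ ⊗ (⟪ r ⟫ ⊗ (⟪ sin r ⟫ ⊗ ⟪ cos⁻¹ ⟫))
      ≈⟨ ⊗-congˡ (boundedᶜ (cos r)) (⊗-assoc ⟪ r ⟫ ⟪ sin r ⟫ ⟪ cos⁻¹ ⟫) ⟨
    ⟪ cos r ⟫ ⊗ (⟪ r*sin ⟫ ⊗ ⟪ cos⁻¹ ⟫)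
      ≈⟨ ⊗-congˡ (boundedᶜ (cos r)) (⊗-comm ⟪ r*sin ⟫ ⟪ cos⁻¹ ⟫) ⟩
    ⟪ cos r ⟫ ⊗ (⟪ cos⁻¹ ⟫ ⊗ ⟪ r*sin ⟫)               ≈⟨ ⊗-assoc ⟪ cos r ⟫ ⟪ cos⁻¹ ⟫ ⟪ r*sin ⟫ ⟨
    ⟪ cos r ⟫ ⊗ ⟪ cos⁻¹ ⟫ ⊗ ⟪ r*sin ⟫                 ≈⟨ ⊗-comm (⟪ cos r ⟫ ⊗ ⟪ cos⁻¹ ⟫) ⟪ r*sin ⟫ ⟩
    ⟪ r*sin ⟫ ⊗ (⟪ cos r ⟫ ⊗ ⟪ cos⁻¹ ⟫)               ≈⟨ ⊗-congˡ (boundedᶜ r*sin) cos*cos⁻¹∼1 ⟩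
    ⟪ r*sin ⟫ ⊗ real (const 1ℚ)                       ≈⟨ ⊗-identityʳ ⟪ r*sin ⟫ ⟩
    ⟪ r ⟫ ⊗ ⟪ sin r ⟫                                 ≈⟨ ⊗-congˡ (boundedᶜ r) sin-∼ ⟩
    ⟪ r ⟫ ⊗ (⟪ r ⟫ ⊗ real (seq (F 1)))                ≈⟨ r*r*-∼ (bounded (F 1)) ⟩
    real (const s ⊛ seq (F 1))                        ∎)
    where
    cos⁻¹ r*sin : ℂ
    cos⁻¹ = inverse (cos r) c
    r*sin = r *ᶜ sin r
    r*tan∼ρ : ⟪ r ⟫ ⊗ (⟪ sin r ⟫ ⊗ ⟪ cos⁻¹ ⟫) ∼ᶜ real (const ρ)
    r*tan∼ρ = ≈ᴿ⇒∼ (re (r *ᶜ tan r c)) (constᴿ ρ) re≈ , ≈ᴿ⇒∼ (im (r *ᶜ tan r c)) (constᴿ 0ℚ) im≈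
    cos*cos⁻¹∼1 : ⟪ cos r ⟫ ⊗ ⟪ cos⁻¹ ⟫ ∼ᶜ real (const 1ℚ)
    cos*cos⁻¹∼1 =
        ≈ᴿ⇒∼ (re (cos r *ᶜ cos⁻¹)) (constᴿ 1ℚ) (proj₁ (inverse-correct (cos r) c))
      , ≈ᴿ⇒∼ (im (cos r *ᶜ cos⁻¹)) (constᴿ 0ℚ) (proj₂ (inverse-correct (cos r) c))

-- Nonvanishing of the cosine and irrationality of `r tan r`

apart-re⇒#0 : ∀ z → Apart (seq (re z)) → z #0
apart-re⇒#0 z (ε , 0<ε , N , ε≤) =
  ε * ε , positive⁻¹ (ε * ε) {{pos*pos⇒pos ε {{positive 0<ε}} ε {{positive 0<ε}}}} , N , λ {n} N≤n → begin
    ε * ε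
      ≤⟨ *-mono-≤-nonNeg (<⇒≤ 0<ε) (0≤∣p∣ (seq (re z) n)) (ε≤ N≤n) (ε≤ N≤n) ⟩
    ∣ seq (re z) n ∣ * ∣ seq (re z) n ∣                      ≡⟨ ∣∣*∣∣ (seq (re z) n) ⟩
    seq (re z) n * seq (re z) n
      ≡⟨ +-identityʳ (seq (re z) n * seq (re z) n) ⟨
    seq (re z) n * seq (re z) n + 0ℚ
      ≤⟨ +-monoʳ-≤ (seq (re z) n * seq (re z) n) (0≤square (seq (im z) n)) ⟩
    seq (re z) n * seq (re z) n + seq (im z) n * seq (im z) n ∎
  where
  open ≤-Reasoning
  ∣∣*∣∣ : ∀ p → ∣ p ∣ * ∣ p ∣ ≡ p * p
  ∣∣*∣∣ p with ∣p∣≡p∨∣p∣≡-p p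
  ... | inj₁ eq = cong₂ _*_ eq eq
  ... | inj₂ eq = trans (cong₂ _*_ eq eq) (solve 1 (λ p → :- p :* :- p := p :* p) refl p)
  0≤square : ∀ p → 0ℚ ≤ p * p
  0≤square p = subst (0ℚ ≤_) (∣∣*∣∣ p) (*-nonNeg (0≤∣p∣ p) (0≤∣p∣ p))

theorem1 : (r : ℂ) (s : ℚ) → r ^ᶜ 2 ≈ ι s → s ≢ 0ℚ →
    Σ[ c ∈ cos r #0 ] ¬ Rational (r *ᶜ tan r c)
theorem1 r s r²≈s s≢0 = cos#0 , irrational
  where
  open Trigonometric r s r²≈s
  open Series (- s) using (F)

  -s≢0 : - s ≢ 0ℚ
  -s≢0 -s≡0 = s≢0 (trans (solve 1 (λ s → s := :- :- s) refl s) (cong -_ -s≡0))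

  open LinearForms (- s) -s≢0 using (form; NonTrivial; independent)

  cos#0 : cos r #0
  -- The real part of `cos r` is the form with coefficients 1 and 0.
  cos#0 = apart-re⇒#0 (cos r) (apart-factor 1ℚ
    (∼-trans (≡⇒∼ λ n → solve 2 (λ f g → con 1ℚ :* f :+ con 0ℚ :* g := con 1ℚ :* f) refl (seq (F 0) n) (seq (F 1) n))
      (⊛-congˡ (bounded-const 1ℚ) (∼-sym (re-∼ cos-∼))))
    (independent (+ 1) (+ 0) λ ()))

  irrational : ¬ Rational (r *ᶜ tan r cos#0)
  irrational (ρ , r*tan≈ρ) = apart⇒≁0 (independent i j nonTrivial) form∼0
    where
    i j : ℤ
    -- The coefficients of `s F 1 - ρ F 0`, multiplied by the common denominator `D` to become
    -- integers.
    i = ↥ (- ρ) ℤ.* ↧ s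
    j = ↥ s ℤ.* ↧ ρ

    D : ℚ
    D = fromℕ (↧ₙ ρ) * fromℕ (↧ₙ s)

    nonTrivial : NonTrivial i j
    -- The coefficient of `F 1` is nonzero because `s` is; this covers `ρ = 0` as well.
    nonTrivial (_ , j≡0) with ℤ.i*j≡0⇒i≡0∨j≡0 (↥ s) j≡0
    ... | inj₁ ↥s≡0 = s≢0 (↥p≡0⇒p≡0 s ↥s≡0)
    ... | inj₂ ()

    i-ℚ : fromℤ i ≡ - ρ * D
    i-ℚ = begin
      fromℤ i                                   ≡⟨ fromℤ-* (↥ (- ρ)) (↧ s) ⟩
      fromℤ (↥ (- ρ)) * fromℕ (↧ₙ s)            ≡⟨ cong (_* fromℕ (↧ₙ s)) (*-↧≡↥ (- ρ)) ⟨
      - ρ * fromℕ (↧ₙ (- ρ)) * fromℕ (↧ₙ s)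
        -- Negation is defined by cases on the numerator, so the denominators of `- ρ` and `ρ` agree
        -- only propositionally.
        ≡⟨ cong (λ d → - ρ * fromℕ d * fromℕ (↧ₙ s)) (ℤ.+-injective (↧-neg ρ)) ⟩
      - ρ * fromℕ (↧ₙ ρ) * fromℕ (↧ₙ s)         ≡⟨ *-assoc (- ρ) (fromℕ (↧ₙ ρ)) (fromℕ (↧ₙ s)) ⟩
      - ρ * D                                   ∎
      where open ≡-Reasoning

    j-ℚ : fromℤ j ≡ s * D
    j-ℚ = begin
      fromℤ j                               ≡⟨ fromℤ-* (↥ s) (↧ ρ) ⟩
      fromℤ (↥ s) * fromℕ (↧ₙ ρ)            ≡⟨ cong (_* fromℕ (↧ₙ ρ)) (*-↧≡↥ s) ⟨
      s * fromℕ (↧ₙ s) * fromℕ (↧ₙ ρ)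
        ≡⟨ solve 3 (λ s d e → s :* d :* e := s :* (e :* d)) refl s (fromℕ (↧ₙ s)) (fromℕ (↧ₙ ρ)) ⟩
      s * D                                 ∎
      where open ≡-Reasoning

    open import Relation.Binary.Reasoning.Setoid ∼-setoid

    form∼0 : form i j 0 ∼ const 0ℚ
    form∼0 = begin
      form i j 0                                                  ≈⟨ ≡⇒∼ expand ⟩
      const D ⊛ (const s ⊛ seq (F 1) ⊕ ⊝ (const ρ ⊛ seq (F 0)))
        ≈⟨ ⊛-congˡ (bounded-const D) (⊕-cong (r*tan-∼ cos#0 ρ r*tan≈ρ) ∼-refl) ⟨
      const D ⊛ (const ρ ⊛ seq (F 0) ⊕ ⊝ (const ρ ⊛ seq (F 0)))
        ≈⟨ ≡⇒∼ (λ n → solve 2 (λ d c → d :* (c :+ :- c) := con 0ℚ) refl D (ρ * seq (F 0) n)) ⟩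
      const 0ℚ                                                    ∎
      where
      expand : ∀ n → form i j 0 n ≡ D * (s * seq (F 1) n + - (ρ * seq (F 0) n))
      expand n = trans (cong₂ (λ a b → a * seq (F 0) n + b * seq (F 1) n) i-ℚ j-ℚ)
        (solve 5 (λ ρ d s f g → :- ρ :* d :* f :+ s :* d :* g := d :* (s :* g :+ :- (ρ :* f))) refl
          ρ D s (seq (F 0) n) (seq (F 1) n))
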